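{- Let $(X,S)$ be a $\frac12$-homogeneous coherent configuration. Let $L(S)=\mathbb C^S$ with its standard inner product and standard basis $S$, equipped with the bilinear multiplication $L(\dot\nabla)$ determined on basis elements by $a\cdot b=\sum_{c\in S}\dot\nabla_{ab}^c\,c$, and with unit element $L(e)=\sum_{p\in S,\,p\subseteq\mathrm{id}_X}p$, where $\dot\nabla_{ab}^c=\sqrt{\frac{\|c\|}{\|a\|\|b\|}}\,\nabla_{ab}^c$. Then the algebra $(L(S),L(\dot\nabla),L(e))$ in the category of finite dimensional Hilbert spaces is an $H^*$-algebra.
   Context: A coherent configuration $(X,S)$ is a finite set $X$ with a partition $S$ of $X\times X$ such that: if $p\in S$ contains some $(x,x)$ then $p\subseteq\mathrm{id}_X$; for $a,b,c\in S$ the number $\nabla_{ab}^c$ of $z\in X$ with $(x,z)\in a$, $(z,y)\in b$ is the same for all $(x,y)\in c$; and $c\in S$ implies $c^{ -1}=\{(y,x):(x,y)\in c\}\in S$. The valency $\|a\|$ of $a\in S$ is the number of $y\in X$ with $(x,y)\in a$, for any $x$ for which at least one such $y$ exists (independent of $x$). $(X,S)$ is $\frac12$-homogeneous if all $p\in S$ with $p\subseteq \mathrm{id}_X$ have the same cardinality. $L$ is the functor sending a finite set $Y$ to $\mathbb C^Y$ and a non-negative real matrix to the corresponding linear map in the standard bases. An $H^*$-algebra is an algebra $A$ over $\mathbb C$ equipped with an anti-linear involution $\dagger\colon A\to A$ that is also a Hilbert space satisfying $\langle ab|c\rangle=\langle b|a^\dagger c\rangle=\langle a|cb^\dagger\rangle$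 for all $a,b,c\in A$. (Being an $H^*$-algebra here means that such an involution exists for the given algebra and inner product.) -}

module Defs where

open import Algebra.Bundles using (CommutativeRing; Ring)
open import Algebra.Core using (Op₁; Op₂)
import Algebra.Definitions
import Algebra.Structures
open import Algebra.Module.Bundles using (LeftModule)
open import Data.Bool.Base using (if_then_else_)
open import Data.Fin.Base using (Fin; zero; suc)
import Data.Fin.Properties as Fin
open import Data.Integer.Base as ℤ using (+_)
import Data.Integer.Properties as ℤ
open import Data.Nat.Base as ℕ using (ℕ; zero; suc; z≤n; s≤s)
import Data.Nat.Properties as ℕ
open import Data.Nat.Solver using () renaming (module +-*-Solver to ℕ-Solver)
open import Data.Product.Base using (∃₂; ∃-syntax; _×_; _,_; proj₁; proj₂)
open import Data.Rational.Base as ℚ using (ℚ; 0ℚ; 1ℚ; ½)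
import Data.Rational.Properties as ℚ
open import Data.Rational.Solver using () renaming (module +-*-Solver to ℚ-Solver)
open import Data.Rational.Unnormalised.Base as ℚᵘ using (mkℚᵘ)
import Data.Rational.Unnormalised.Properties as ℚᵘ
open import Data.Sum.Base using (inj₁; inj₂)
open import Data.Vec.Base using (allFin; allPairs; count; tabulate)
open import Data.Vec.Functional using (Vector)
open import Function.Base using (id; _∘_)
open import Function.Bundles using (_⇔_)
open import Level using (0ℓ)
open import Relation.Binary.Bundles using (Setoid)
open import Relation.Binary.Structures using (IsEquivalence)
open import Relation.Binary.PropositionalEquality as ≡ using (_≡_; refl; cong; cong₂; subst; subst₂)
open import Relation.Nullary.Decidable.Core using (does; yes; no)
open import Relation.Nullary.Decidable using (_→-dec_; _×-dec_)
open import Relation.Nullary.Negation using (contradiction)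
open import Relation.Unary using (Pred; Decidable)

module _ where
  open import Data.Rational.Base using (mkℚ; _+_; _*_; _-_; -_; _/_; ∣_∣; _<_; _≤_; ↧ₙ_; positive)
  open ℚ-Solver

  ½-split : ∀ ε → ½ * ε + ½ * ε ≡ ε
  ½-split ε = ≡.trans (≡.sym (ℚ.*-distribʳ-+ ε ½ ½)) (ℚ.*-identityˡ ε)

  ½-pos : ∀ {ε} → 0ℚ < ε → 0ℚ < ½ * ε
  ½-pos {ε} 0<ε = ℚ.positive⁻¹ _ {{ℚ.pos*pos⇒pos ½ ε {{positive 0<ε}}}}

  ∣-∣-swap : ∀ p q → ∣ p - q ∣ ≡ ∣ q - p ∣
  ∣-∣-swap p q = ≡.trans
    (cong ∣_∣ (solve 2 (λ a b → a :- b := :- (b :- a)) refl p q)) (ℚ.∣-p∣≡∣p∣ _)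

  ∣-∣-triangle : ∀ p q r → ∣ p - r ∣ ≤ ∣ p - q ∣ + ∣ q - r ∣
  ∣-∣-triangle p q r = subst (_≤ ∣ p - q ∣ + ∣ q - r ∣)
    (cong ∣_∣ (solve 3 (λ a b c → a :- b :+ (b :- c) := a :- c) refl p q r))
    (ℚ.∣p+q∣≤∣p∣+∣q∣ (p - q) (q - r))

  ∣p-p∣≡0 : ∀ p → ∣ p - p ∣ ≡ 0ℚ
  ∣p-p∣≡0 p = cong ∣_∣ (ℚ.+-inverseʳ p)

  ∣-∣-+ : ∀ p p′ q q′ {δ ε} → ∣ p - p′ ∣ < δ → ∣ q - q′ ∣ < ε →
          ∣ (p + q) - (p′ + q′) ∣ < δ + ε
  ∣-∣-+ p p′ q q′ {δ} {ε} h k = ℚ.≤-<-trans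
    (subst (_≤ ∣ p - p′ ∣ + ∣ q - q′ ∣)
      (cong ∣_∣ (solve 4 (λ a b c d → a :- b :+ (c :- d) := (a :+ c) :- (b :+ d)) refl p p′ q q′))
      (ℚ.∣p+q∣≤∣p∣+∣q∣ (p - p′) (q - q′)))
    (ℚ.+-mono-< h k)

  ∣-∣-neg : ∀ p p′ → ∣ (- p) - (- p′) ∣ ≡ ∣ p - p′ ∣
  ∣-∣-neg p p′ = ≡.trans
    (cong ∣_∣ (solve 2 (λ a b → :- a :- :- b := :- (a :- b)) refl p p′)) (ℚ.∣-p∣≡∣p∣ _)

  *-bound : ∀ p q {B δ} → ∣ p ∣ < B → ∣ q ∣ < δ → ∣ p * q ∣ < B * δ
  *-bound p q {B} {δ} p<B q<δ = ℚ.≤-<-trans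
    (subst (_≤ B * ∣ q ∣) (≡.sym (ℚ.∣p*q∣≡∣p∣*∣q∣ p q))
      (ℚ.*-monoʳ-≤-nonNeg ∣ q ∣ {{ℚ.∣-∣-nonNeg q}} (ℚ.<⇒≤ p<B)))
    (ℚ.*-monoʳ-<-pos B {{positive (ℚ.≤-<-trans (ℚ.0≤∣p∣ p) p<B)}} q<δ)

  ∣-∣-* : ∀ p p′ q q′ {B C δ} → ∣ p ∣ < B → ∣ q′ ∣ < C →
          ∣ p - p′ ∣ < δ → ∣ q - q′ ∣ < δ → ∣ p * q - p′ * q′ ∣ < (B + C) * δ
  ∣-∣-* p p′ q q′ {B} {C} {δ} p<B q<C dp dq = subst₂ _<_
    (cong ∣_∣ (solve 4 (λ a b c d → (a :* (c :- d) :+ d :* (a :- b)) := a :* c :- b :* d)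
      refl p p′ q q′))
    (≡.sym (ℚ.*-distribʳ-+ δ B C))
    (ℚ.≤-<-trans (ℚ.∣p+q∣≤∣p∣+∣q∣ (p * (q - q′)) (q′ * (p - p′)))
      (ℚ.+-mono-< (*-bound p (q - q′) p<B dq) (*-bound q′ (p - p′) q<C dp)))

  +/-mono-< : ∀ m n d e .{{_ : ℕ.NonZero d}} .{{_ : ℕ.NonZero e}} →
              m ℕ.* e ℕ.< n ℕ.* d → (+ m) / d < (+ n) / e
  +/-mono-< m n (suc d) (suc e) h = ℚ.toℚᵘ-cancel-< (ℚᵘ.<-respˡ-≃
    (ℚᵘ.≃-sym (ℚ.toℚᵘ-fromℚᵘ (mkℚᵘ (+ m) d)))
    (ℚᵘ.<-respʳ-≃ (ℚᵘ.≃-sym (ℚ.toℚᵘ-fromℚᵘ (mkℚᵘ (+ n) e)))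
      (ℚᵘ.*<* (subst₂ ℤ._<_ (ℤ.pos-* m (suc e)) (ℤ.pos-* n (suc d)) (ℤ.+<+ h)))))

  +/-+ : ∀ m n d .{{_ : ℕ.NonZero d}} → (+ m) / d + (+ n) / d ≡ (+ (m ℕ.+ n)) / d
  +/-+ m n (suc d) = ℚ.toℚᵘ-injective (ℚᵘ.≃-trans
    (ℚ.toℚᵘ-homo-+ ((+ m) / suc d) ((+ n) / suc d))
    (ℚᵘ.≃-trans
      (ℚᵘ.+-cong (ℚ.toℚᵘ-fromℚᵘ (mkℚᵘ (+ m) d)) (ℚ.toℚᵘ-fromℚᵘ (mkℚᵘ (+ n) d)))
      (ℚᵘ.≃-trans (ℚᵘ.*≡* eq) (ℚᵘ.≃-sym (ℚ.toℚᵘ-fromℚᵘ (mkℚᵘ (+ (m ℕ.+ n)) d))))))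
    where
    D = + suc d
    eq : (+ m ℤ.* D ℤ.+ + n ℤ.* D) ℤ.* D ≡ (+ m ℤ.+ + n) ℤ.* (D ℤ.* D)
    eq = ≡.trans (cong (ℤ._* D) (≡.sym (ℤ.*-distribʳ-+ D (+ m) (+ n))))
                 (ℤ.*-assoc (+ m ℤ.+ + n) D D)

  ∣-∣-< : ∀ p q {ε} → p < q + ε → q < p + ε → ∣ p - q ∣ < ε
  ∣-∣-< p q {ε} p<q+ε q<p+ε with ℚ.∣p∣≡p∨∣p∣≡-p (p - q)
  ... | inj₁ eq = subst₂ _<_ (≡.sym eq)
        (solve 2 (λ b e → (b :+ e) :- b := e) refl q ε) (ℚ.+-monoˡ-< (- q) p<q+ε)
  ... | inj₂ eq = subst₂ _<_
        (≡.trans (solve 2 (λ a b → b :- a := :- (a :- b)) refl p q) (≡.sym eq))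
        (solve 2 (λ a e → (a :+ e) :- a := e) refl p ε) (ℚ.+-monoˡ-< (- p) q<p+ε)

  1/<ε : ∀ {ε} → 0ℚ < ε → ∀ n .{{_ : ℕ.NonZero n}} → ↧ₙ ε ℕ.< n → (+ 1) / n < ε
  1/<ε {ε} 0<ε n h with ε | positive 0<ε
  ... | mkℚ ℤ.+[1+ p ] d c | _ = subst ((+ 1) / n <_) (ℚ.↥p/↧p≡p (mkℚ ℤ.+[1+ p ] d c))
        (+/-mono-< 1 (suc p) n (suc d) (ℕ.<-≤-trans
          (subst (ℕ._< n) (≡.sym (ℕ.*-identityˡ (suc d))) h)
          (ℕ.m≤m+n n (p ℕ.* n))))

-- The reals are Cauchy sequences of rationals, with ≈ᴿ (difference tends to 0) as equality.
IsCauchy : (ℕ → ℚ) → Set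
IsCauchy s = ∀ ε → 0ℚ ℚ.< ε → ∃[ N ] ∀ m n → N ℕ.≤ m → N ℕ.≤ n → ℚ.∣ s m ℚ.- s n ∣ ℚ.< ε

record ℝ : Set where
  constructor mkℝ
  field
    seq    : ℕ → ℚ
    cauchy : IsCauchy seq
open ℝ public

infix 4 _≈ᴿ_ _≤ᴿ_

record _≈ᴿ_ (x y : ℝ) : Set where
  constructor mk≈
  field
    close : ∀ ε → 0ℚ ℚ.< ε → ∃[ N ] ∀ n → N ℕ.≤ n → ℚ.∣ seq x n ℚ.- seq y n ∣ ℚ.< ε
open _≈ᴿ_ public

record _≤ᴿ_ (x y : ℝ) : Set where
  constructor mk≤
  field
    below : ∀ ε → 0ℚ ℚ.< ε → ∃[ N ] ∀ n → N ℕ.≤ n → seq x n ℚ.< seq y n ℚ.+ ε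
open _≤ᴿ_ public

pointwise⇒≈ᴿ : ∀ {x y} → (∀ n → seq x n ≡ seq y n) → x ≈ᴿ y
pointwise⇒≈ᴿ {x} {y} x≗y = mk≈ λ ε 0<ε → 0 , λ n _ →
  subst (ℚ._< ε) (≡.sym (≡.trans (cong (λ q → ℚ.∣ q ℚ.- seq y n ∣) (x≗y n)) (∣p-p∣≡0 (seq y n)))) 0<ε

≈ᴿ-isEquivalence : IsEquivalence _≈ᴿ_
≈ᴿ-isEquivalence = record
  { refl  = pointwise⇒≈ᴿ (λ _ → refl)
  ; sym   = λ {x} {y} x≈y → mk≈ λ ε 0<ε → let (N , h) = close x≈y ε 0<ε in
      N , λ n N≤n → subst (ℚ._< ε) (∣-∣-swap (seq x n) (seq y n)) (h n N≤n)
  ; trans = λ {x} {y} {z} x≈y y≈z → mk≈ λ ε 0<ε →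
      let (M , h) = close x≈y (½ ℚ.* ε) (½-pos 0<ε)
          (N , k) = close y≈z (½ ℚ.* ε) (½-pos 0<ε)
      in M ℕ.⊔ N , λ n le → ℚ.≤-<-trans (∣-∣-triangle (seq x n) (seq y n) (seq z n))
           (subst (_ ℚ.<_) (½-split ε) (ℚ.+-mono-<
             (h n (ℕ.≤-trans (ℕ.m≤m⊔n M N) le)) (k n (ℕ.≤-trans (ℕ.m≤n⊔m M N) le))))
  }

eventually-bounded : ∀ x → ∃₂ λ B N → 0ℚ ℚ.< B × (∀ n → N ℕ.≤ n → ℚ.∣ seq x n ∣ ℚ.< B)
eventually-bounded x = let (N , h) = cauchy x 1ℚ (ℚ.positive⁻¹ 1ℚ) in
  1ℚ ℚ.+ ℚ.∣ seq x N ∣ , N ,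
  ℚ.<-≤-trans (ℚ.positive⁻¹ 1ℚ)
    (subst (ℚ._≤ 1ℚ ℚ.+ ℚ.∣ seq x N ∣) (ℚ.+-identityʳ 1ℚ) (ℚ.+-monoʳ-≤ 1ℚ (ℚ.0≤∣p∣ (seq x N)))) ,
  λ n le → ℚ.≤-<-trans
    (subst (λ q → ℚ.∣ q ∣ ℚ.≤ ℚ.∣ seq x n ℚ.- seq x N ∣ ℚ.+ ℚ.∣ seq x N ∣)
      (ℚ-Solver.solve 2 (λ a b → (a :- b) :+ b := a) refl (seq x n) (seq x N))
      (ℚ.∣p+q∣≤∣p∣+∣q∣ (seq x n ℚ.- seq x N) (seq x N)))
    (ℚ.+-monoˡ-< ℚ.∣ seq x N ∣ (h n N le ℕ.≤-refl))
  where open ℚ-Solver using (_:-_; _:+_; _:=_)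

-- A tolerance δ with (B + C) δ ≡ ε.
tolerance : ∀ {B C ε} → 0ℚ ℚ.< B → 0ℚ ℚ.< C → 0ℚ ℚ.< ε →
            ∃[ δ ] 0ℚ ℚ.< δ × (B ℚ.+ C) ℚ.* δ ≡ ε
tolerance {B} {C} {ε} 0<B 0<C 0<ε = (ℚ.1/ K) ℚ.* ε ,
  ℚ.positive⁻¹ _ {{ℚ.pos*pos⇒pos (ℚ.1/ K) {{ℚ.1/pos⇒pos K}} ε {{ℚ.positive 0<ε}}}} ,
  ≡.trans (≡.sym (ℚ.*-assoc K (ℚ.1/ K) ε))
    (≡.trans (cong (ℚ._* ε) (ℚ.*-inverseʳ K)) (ℚ.*-identityˡ ε))
  where
  K = B ℚ.+ C
  instance
    K-pos : ℚ.Positive K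
    K-pos = ℚ.pos+pos⇒pos B {{ℚ.positive 0<B}} C {{ℚ.positive 0<C}}
    K-nz : ℚ.NonZero K
    K-nz = ℚ.pos⇒nonZero K

-- Sealed so that the type checker never compares moduli of convergence.
abstract
  ratio-cauchy : ∀ q → IsCauchy (λ _ → q)
  ratio-cauchy q ε 0<ε = 0 , λ _ _ _ _ → subst (ℚ._< ε) (≡.sym (∣p-p∣≡0 q)) 0<ε

  +-cauchy : ∀ x y → IsCauchy (λ n → seq x n ℚ.+ seq y n)
  +-cauchy x y ε 0<ε =
    let (M , h) = cauchy x (½ ℚ.* ε) (½-pos 0<ε)
        (N , k) = cauchy y (½ ℚ.* ε) (½-pos 0<ε)
        l = ℕ.m≤m⊔n M N
        r = ℕ.m≤n⊔m M N
    in M ℕ.⊔ N , λ m n le le′ → subst (_ ℚ.<_) (½-split ε)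
         (∣-∣-+ (seq x m) (seq x n) (seq y m) (seq y n)
           (h m n (ℕ.≤-trans l le) (ℕ.≤-trans l le′))
           (k m n (ℕ.≤-trans r le) (ℕ.≤-trans r le′)))

  neg-cauchy : ∀ x → IsCauchy (λ n → ℚ.- seq x n)
  neg-cauchy x ε 0<ε = let (N , h) = cauchy x ε 0<ε in
    N , λ m n le le′ → subst (ℚ._< ε) (≡.sym (∣-∣-neg (seq x m) (seq x n))) (h m n le le′)

  *-cauchy : ∀ x y → IsCauchy (λ n → seq x n ℚ.* seq y n)
  *-cauchy x y ε 0<ε =
    let (B , N₁ , 0<B , b) = eventually-bounded x
        (C , N₂ , 0<C , c) = eventually-bounded y
        (δ , 0<δ , eq)     = tolerance 0<B 0<C 0<ε
        (N₃ , h)           = cauchy x δ 0<δ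
        (N₄ , k)           = cauchy y δ 0<δ
        N                  = (N₁ ℕ.⊔ N₂) ℕ.⊔ (N₃ ℕ.⊔ N₄)
        le₁ = ℕ.≤-trans (ℕ.m≤m⊔n N₁ N₂) (ℕ.m≤m⊔n _ (N₃ ℕ.⊔ N₄))
        le₂ = ℕ.≤-trans (ℕ.m≤n⊔m N₁ N₂) (ℕ.m≤m⊔n _ (N₃ ℕ.⊔ N₄))
        le₃ = ℕ.≤-trans (ℕ.m≤m⊔n N₃ N₄) (ℕ.m≤n⊔m (N₁ ℕ.⊔ N₂) _)
        le₄ = ℕ.≤-trans (ℕ.m≤n⊔m N₃ N₄) (ℕ.m≤n⊔m (N₁ ℕ.⊔ N₂) _)
    in N , λ m n le le′ → subst (_ ℚ.<_) eq
         (∣-∣-* (seq x m) (seq x n) (seq y m) (seq y n)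
           (b m (ℕ.≤-trans le₁ le)) (c n (ℕ.≤-trans le₂ le′))
           (h m n (ℕ.≤-trans le₃ le) (ℕ.≤-trans le₃ le′))
           (k m n (ℕ.≤-trans le₄ le) (ℕ.≤-trans le₄ le′)))

infixl 6 _+ᴿ_
infixl 7 _*ᴿ_
infix  8 -ᴿ_

_+ᴿ_ : ℝ → ℝ → ℝ
x +ᴿ y = mkℝ (λ n → seq x n ℚ.+ seq y n) (+-cauchy x y)

-ᴿ_ : ℝ → ℝ
-ᴿ x = mkℝ (λ n → ℚ.- seq x n) (neg-cauchy x)

_*ᴿ_ : ℝ → ℝ → ℝ
x *ᴿ y = mkℝ (λ n → seq x n ℚ.* seq y n) (*-cauchy x y)

ratio : ℚ → ℝ
ratio q = mkℝ (λ _ → q) (ratio-cauchy q)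

0ᴿ 1ᴿ : ℝ
0ᴿ = ratio 0ℚ
1ᴿ = ratio 1ℚ

fromℕ : ℕ → ℝ
fromℕ n = ratio ((+ n) ℚ./ 1)

+ᴿ-cong : ∀ {x x′ y y′} → x ≈ᴿ x′ → y ≈ᴿ y′ → x +ᴿ y ≈ᴿ x′ +ᴿ y′
+ᴿ-cong {x} {x′} {y} {y′} p q = mk≈ λ ε 0<ε →
  let (M , h) = close p (½ ℚ.* ε) (½-pos 0<ε)
      (N , k) = close q (½ ℚ.* ε) (½-pos 0<ε)
  in M ℕ.⊔ N , λ n le → subst (_ ℚ.<_) (½-split ε)
       (∣-∣-+ (seq x n) (seq x′ n) (seq y n) (seq y′ n)
         (h n (ℕ.≤-trans (ℕ.m≤m⊔n M N) le)) (k n (ℕ.≤-trans (ℕ.m≤n⊔m M N) le)))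

-ᴿ-cong : ∀ {x x′} → x ≈ᴿ x′ → -ᴿ x ≈ᴿ -ᴿ x′
-ᴿ-cong {x} {x′} p = mk≈ λ ε 0<ε → let (N , h) = close p ε 0<ε in
  N , λ n le → subst (ℚ._< ε) (≡.sym (∣-∣-neg (seq x n) (seq x′ n))) (h n le)

*ᴿ-cong : ∀ {x x′ y y′} → x ≈ᴿ x′ → y ≈ᴿ y′ → x *ᴿ y ≈ᴿ x′ *ᴿ y′
*ᴿ-cong {x} {x′} {y} {y′} p q = mk≈ λ ε 0<ε →
  let (B , N₁ , 0<B , b) = eventually-bounded x
      (C , N₂ , 0<C , c) = eventually-bounded y′
      (δ , 0<δ , eq)     = tolerance 0<B 0<C 0<ε
      (N₃ , h)           = close p δ 0<δ
      (N₄ , k)           = close q δ 0<δ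
      le₁ = ℕ.≤-trans (ℕ.m≤m⊔n N₁ N₂) (ℕ.m≤m⊔n _ (N₃ ℕ.⊔ N₄))
      le₂ = ℕ.≤-trans (ℕ.m≤n⊔m N₁ N₂) (ℕ.m≤m⊔n _ (N₃ ℕ.⊔ N₄))
      le₃ = ℕ.≤-trans (ℕ.m≤m⊔n N₃ N₄) (ℕ.m≤n⊔m (N₁ ℕ.⊔ N₂) _)
      le₄ = ℕ.≤-trans (ℕ.m≤n⊔m N₃ N₄) (ℕ.m≤n⊔m (N₁ ℕ.⊔ N₂) _)
  in (N₁ ℕ.⊔ N₂) ℕ.⊔ (N₃ ℕ.⊔ N₄) , λ n le → subst (_ ℚ.<_) eq
       (∣-∣-* (seq x n) (seq x′ n) (seq y n) (seq y′ n)
         (b n (ℕ.≤-trans le₁ le)) (c n (ℕ.≤-trans le₂ le))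
         (h n (ℕ.≤-trans le₃ le)) (k n (ℕ.≤-trans le₄ le)))

private
  module ℝ-Laws where
    open Algebra.Definitions _≈ᴿ_

    +-assoc : Associative _+ᴿ_
    +-assoc x y z = pointwise⇒≈ᴿ λ n → ℚ.+-assoc (seq x n) (seq y n) (seq z n)

    +-comm : Commutative _+ᴿ_
    +-comm x y = pointwise⇒≈ᴿ λ n → ℚ.+-comm (seq x n) (seq y n)

    +-identity : Identity 0ᴿ _+ᴿ_
    +-identity = (λ x → pointwise⇒≈ᴿ λ n → ℚ.+-identityˡ (seq x n))
               , (λ x → pointwise⇒≈ᴿ λ n → ℚ.+-identityʳ (seq x n))

    +-inverse : Inverse 0ᴿ -ᴿ_ _+ᴿ_
    +-inverse = (λ x → pointwise⇒≈ᴿ λ n → ℚ.+-inverseˡ (seq x n))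
              , (λ x → pointwise⇒≈ᴿ λ n → ℚ.+-inverseʳ (seq x n))

    *-assoc : Associative _*ᴿ_
    *-assoc x y z = pointwise⇒≈ᴿ λ n → ℚ.*-assoc (seq x n) (seq y n) (seq z n)

    *-comm : Commutative _*ᴿ_
    *-comm x y = pointwise⇒≈ᴿ λ n → ℚ.*-comm (seq x n) (seq y n)

    *-identity : Identity 1ᴿ _*ᴿ_
    *-identity = (λ x → pointwise⇒≈ᴿ λ n → ℚ.*-identityˡ (seq x n))
               , (λ x → pointwise⇒≈ᴿ λ n → ℚ.*-identityʳ (seq x n))

    distrib : _*ᴿ_ DistributesOver _+ᴿ_
    distrib = (λ x y z → pointwise⇒≈ᴿ λ n → ℚ.*-distribˡ-+ (seq x n) (seq y n) (seq z n))
            , (λ x y z → pointwise⇒≈ᴿ λ n → ℚ.*-distribʳ-+ (seq x n) (seq y n) (seq z n))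

module _ where
  open ℝ-Laws
  open Algebra.Structures _≈ᴿ_

  ℝ-isAbelianGroup : IsAbelianGroup _+ᴿ_ 0ᴿ -ᴿ_
  ℝ-isAbelianGroup = record
    { isGroup = record
      { isMonoid = record
        { isSemigroup = record
          { isMagma = record { isEquivalence = ≈ᴿ-isEquivalence ; ∙-cong = +ᴿ-cong }
          ; assoc   = +-assoc
          }
        ; identity = +-identity
        }
      ; inverse = +-inverse
      ; ⁻¹-cong = -ᴿ-cong
      }
    ; comm = +-comm
    }

  ℝ-isRing : IsRing _+ᴿ_ _*ᴿ_ -ᴿ_ 0ᴿ 1ᴿ
  ℝ-isRing = record
    { +-isAbelianGroup = ℝ-isAbelianGroup
    ; *-cong     = *ᴿ-cong
    ; *-assoc    = *-assoc
    ; *-identity = *-identity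
    ; distrib    = distrib
    }

ℝ-commutativeRing : CommutativeRing 0ℓ 0ℓ
ℝ-commutativeRing = record
  { isCommutativeRing = record { isRing = ℝ-isRing ; *-comm = ℝ-Laws.*-comm } }

-- ⌊√ n⌋
isqrt : ℕ → ℕ
isqrt zero    = zero
isqrt (suc n) with suc (isqrt n) ℕ.* suc (isqrt n) ℕ.≤? suc n
... | yes _ = suc (isqrt n)
... | no  _ = isqrt n

isqrt-lower : ∀ n → isqrt n ℕ.* isqrt n ℕ.≤ n
isqrt-lower zero    = z≤n
isqrt-lower (suc n) with suc (isqrt n) ℕ.* suc (isqrt n) ℕ.≤? suc n
... | yes p = p
... | no  _ = ℕ.m≤n⇒m≤1+n (isqrt-lower n)

isqrt-upper : ∀ n → n ℕ.< suc (isqrt n) ℕ.* suc (isqrt n)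
isqrt-upper zero    = s≤s z≤n
isqrt-upper (suc n) with suc (isqrt n) ℕ.* suc (isqrt n) ℕ.≤? suc n
... | no  p = ℕ.≰⇒> p
... | yes _ = ℕ.<-≤-trans (s≤s (isqrt-upper n))
                (ℕ.*-mono-< (ℕ.n<1+n (suc (isqrt n))) (ℕ.n<1+n (suc (isqrt n))))

square-cancel-< : ∀ m n → m ℕ.* m ℕ.< n ℕ.* n → m ℕ.< n
square-cancel-< m n h with m ℕ.<? n
... | yes p = p
... | no  p = contradiction h (ℕ.≤⇒≯ (ℕ.*-mono-≤ (ℕ.≮⇒≥ p) (ℕ.≮⇒≥ p)))


isqrt-cross : ∀ D k l .{{_ : ℕ.NonZero k}} →
              isqrt (D ℕ.* (k ℕ.* k)) ℕ.* l ℕ.< suc (isqrt (D ℕ.* (l ℕ.* l))) ℕ.* k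
isqrt-cross D k l = square-cancel-< (A ℕ.* l) (suc B ℕ.* k) (begin-strict
  (A ℕ.* l) ℕ.* (A ℕ.* l)              ≡⟨ sq A l ⟩
  (A ℕ.* A) ℕ.* (l ℕ.* l)              ≤⟨ ℕ.*-monoˡ-≤ (l ℕ.* l) (isqrt-lower (D ℕ.* (k ℕ.* k))) ⟩
  (D ℕ.* (k ℕ.* k)) ℕ.* (l ℕ.* l)      ≡⟨ swap ⟩
  (D ℕ.* (l ℕ.* l)) ℕ.* (k ℕ.* k)      <⟨ ℕ.*-monoˡ-< (k ℕ.* k) {{ℕ.m*n≢0 k k}} (isqrt-upper (D ℕ.* (l ℕ.* l))) ⟩
  (suc B ℕ.* suc B) ℕ.* (k ℕ.* k)      ≡⟨ sq (suc B) k ⟨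
  (suc B ℕ.* k) ℕ.* (suc B ℕ.* k)      ∎)
  where
  open ℕ.≤-Reasoning
  open ℕ-Solver using (solve; _:*_; _:=_)
  A = isqrt (D ℕ.* (k ℕ.* k))
  B = isqrt (D ℕ.* (l ℕ.* l))
  sq : ∀ a b → (a ℕ.* b) ℕ.* (a ℕ.* b) ≡ (a ℕ.* a) ℕ.* (b ℕ.* b)
  sq = solve 2 (λ a b → (a :* b) :* (a :* b) := (a :* a) :* (b :* b)) refl
  swap : (D ℕ.* (k ℕ.* k)) ℕ.* (l ℕ.* l) ≡ (D ℕ.* (l ℕ.* l)) ℕ.* (k ℕ.* k)
  swap = solve 3 (λ a b c → (a :* b) :* c := (a :* c) :* b) refl D (k ℕ.* k) (l ℕ.* l)

module Sqrt (p d : ℕ) .{{_ : ℕ.NonZero d}} where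

  -- With k = 1 + n this is ⌊√(pdk²)⌋ / (dk), which tends to √(pd) / d = √(p/d).
  approx : ℕ → ℚ
  approx n = ((+ isqrt ((p ℕ.* d) ℕ.* (suc n ℕ.* suc n))) ℚ./ (d ℕ.* suc n)) {{ℕ.m*n≢0 d (suc n)}}

  approx-< : ∀ {ε} → 0ℚ ℚ.< ε → ∀ m n → ℚ.↧ₙ ε ℕ.≤ n → approx m ℚ.< approx n ℚ.+ ε
  approx-< {ε} 0<ε m n le = ℚ.<-trans
    (+/-mono-< A (suc B) (d ℕ.* k) (d ℕ.* l) cross)
    (subst (ℚ._< approx n ℚ.+ ε)
      (≡.trans (+/-+ B 1 (d ℕ.* l)) (cong (λ x → (+ x) ℚ./ (d ℕ.* l)) (ℕ.+-comm B 1)))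
      (ℚ.+-monoʳ-< (approx n) (1/<ε 0<ε (d ℕ.* l) (ℕ.≤-trans (s≤s le) (ℕ.m≤n*m l d)))))
    where
    k = suc m
    l = suc n
    A = isqrt ((p ℕ.* d) ℕ.* (k ℕ.* k))
    B = isqrt ((p ℕ.* d) ℕ.* (l ℕ.* l))
    instance
      dk≢0 = ℕ.m*n≢0 d k
      dl≢0 = ℕ.m*n≢0 d l
    open ℕ-Solver using (solve; _:*_; _:=_)
    cross : A ℕ.* (d ℕ.* l) ℕ.< suc B ℕ.* (d ℕ.* k)
    cross = subst₂ ℕ._<_
      (solve 3 (λ a b c → (a :* b) :* c := a :* (c :* b)) refl A l d)
      (solve 3 (λ a b c → (a :* b) :* c := a :* (c :* b)) refl (suc B) k d)
      (ℕ.*-monoˡ-< d (isqrt-cross (p ℕ.* d) k l))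

  abstract
    approx-cauchy : IsCauchy approx
    approx-cauchy ε 0<ε = ℚ.↧ₙ ε , λ m n le le′ →
      ∣-∣-< (approx m) (approx n) (approx-< 0<ε m n le′) (approx-< 0<ε n m le)

√[_/_] : (p d : ℕ) .{{_ : ℕ.NonZero d}} → ℝ
√[ p / d ] = mkℝ (Sqrt.approx p d) (Sqrt.approx-cauchy p d)

record ℂ : Set where
  constructor _+i_
  field
    re im : ℝ
open ℂ public

infix 4 _≈_

record _≈_ (z w : ℂ) : Set where
  constructor _,_
  field
    re≈ : re z ≈ᴿ re w
    im≈ : im z ≈ᴿ im w
open _≈_ public

infixl 6 _+_
infixl 7 _*_
infix  8 -_

_+_ _*_ : Op₂ ℂ
z + w = (re z +ᴿ re w) +i (im z +ᴿ im w)
z * w = (re z *ᴿ re w +ᴿ -ᴿ (im z *ᴿ im w)) +i (re z *ᴿ im w +ᴿ im z *ᴿ re w)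

-_ conj : Op₁ ℂ
- z    = (-ᴿ re z) +i (-ᴿ im z)
conj z = re z +i (-ᴿ im z)

real : ℝ → ℂ
real x = x +i 0ᴿ

0ᶜ 1ᶜ : ℂ
0ᶜ = real 0ᴿ
1ᶜ = real 1ᴿ

module _ where
  open Algebra.Definitions _≈_
  open Algebra.Structures _≈_
  private
    module R = CommutativeRing ℝ-commutativeRing
  open ℚ-Solver using (solve; _:+_; _:*_; _:-_; _:=_; :-_; con)

  ≈-isEquivalence : IsEquivalence _≈_
  ≈-isEquivalence = record
    { refl  = R.refl , R.refl
    ; sym   = λ p → R.sym (re≈ p) , R.sym (im≈ p)
    ; trans = λ p q → R.trans (re≈ p) (re≈ q) , R.trans (im≈ p) (im≈ q)
    }

  ℂ-setoid : Setoid 0ℓ 0ℓ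
  ℂ-setoid = record { isEquivalence = ≈-isEquivalence }

  *-cong : Congruent₂ _*_
  *-cong p q =
    R.+-cong (R.*-cong (re≈ p) (re≈ q)) (R.-‿cong (R.*-cong (im≈ p) (im≈ q))) ,
    R.+-cong (R.*-cong (re≈ p) (im≈ q)) (R.*-cong (im≈ p) (re≈ q))

  *-comm : Commutative _*_
  *-comm (a +i b) (c +i d) =
    (pointwise⇒≈ᴿ λ n → solve 4 (λ a b c d → a :* c :+ :- (b :* d) := c :* a :+ :- (d :* b))
      refl (seq a n) (seq b n) (seq c n) (seq d n)) ,
    (pointwise⇒≈ᴿ λ n → solve 4 (λ a b c d → a :* d :+ b :* c := c :* b :+ d :* a)
      refl (seq a n) (seq b n) (seq c n) (seq d n))

  *-assoc : Associative _*_
  *-assoc (a +i b) (c +i d) (e +i f) =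
    (pointwise⇒≈ᴿ λ n → solve 6 (λ a b c d e f →
        (a :* c :+ :- (b :* d)) :* e :+ :- ((a :* d :+ b :* c) :* f)
        := a :* (c :* e :+ :- (d :* f)) :+ :- (b :* (c :* f :+ d :* e)))
      refl (seq a n) (seq b n) (seq c n) (seq d n) (seq e n) (seq f n)) ,
    (pointwise⇒≈ᴿ λ n → solve 6 (λ a b c d e f →
        (a :* c :+ :- (b :* d)) :* f :+ (a :* d :+ b :* c) :* e
        := a :* (c :* f :+ d :* e) :+ b :* (c :* e :+ :- (d :* f)))
      refl (seq a n) (seq b n) (seq c n) (seq d n) (seq e n) (seq f n))

  *-identityˡ : LeftIdentity 1ᶜ _*_
  *-identityˡ (a +i b) =
    (pointwise⇒≈ᴿ λ n → solve 2 (λ a b → con 1ℚ :* a :+ :- (con 0ℚ :* b) := a) refl (seq a n) (seq b n)) ,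
    (pointwise⇒≈ᴿ λ n → solve 2 (λ a b → con 1ℚ :* b :+ con 0ℚ :* a := b) refl (seq a n) (seq b n))

  *-distribˡ-+ : _*_ DistributesOverˡ _+_
  *-distribˡ-+ (a +i b) (c +i d) (e +i f) =
    (pointwise⇒≈ᴿ λ n → solve 6 (λ a b c d e f →
        a :* (c :+ e) :+ :- (b :* (d :+ f)) := (a :* c :+ :- (b :* d)) :+ (a :* e :+ :- (b :* f)))
      refl (seq a n) (seq b n) (seq c n) (seq d n) (seq e n) (seq f n)) ,
    (pointwise⇒≈ᴿ λ n → solve 6 (λ a b c d e f →
        a :* (d :+ f) :+ b :* (c :+ e) := (a :* d :+ b :* c) :+ (a :* f :+ b :* e))
      refl (seq a n) (seq b n) (seq c n) (seq d n) (seq e n) (seq f n))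

  +-isAbelianGroup : IsAbelianGroup _+_ 0ᶜ -_
  +-isAbelianGroup = record
    { isGroup = record
      { isMonoid = record
        { isSemigroup = record
          { isMagma = record
            { isEquivalence = ≈-isEquivalence
            ; ∙-cong = λ p q → R.+-cong (re≈ p) (re≈ q) , R.+-cong (im≈ p) (im≈ q)
            }
          ; assoc = λ z w v → R.+-assoc (re z) (re w) (re v) , R.+-assoc (im z) (im w) (im v)
          }
        ; identity = (λ z → R.+-identityˡ (re z) , R.+-identityˡ (im z))
                   , (λ z → R.+-identityʳ (re z) , R.+-identityʳ (im z))
        }
      ; inverse = (λ z → R.-‿inverseˡ (re z) , R.-‿inverseˡ (im z))
                , (λ z → R.-‿inverseʳ (re z) , R.-‿inverseʳ (im z))
      ; ⁻¹-cong = λ p → R.-‿cong (re≈ p) , R.-‿cong (im≈ p)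
      }
    ; comm = λ z w → R.+-comm (re z) (re w) , R.+-comm (im z) (im w)
    }

  ℂ-isCommutativeRing : IsCommutativeRing _+_ _*_ -_ 0ᶜ 1ᶜ
  ℂ-isCommutativeRing = record
    { isRing = record
      { +-isAbelianGroup = +-isAbelianGroup
      ; *-cong     = *-cong
      ; *-assoc    = *-assoc
      ; *-identity = comm∧idˡ⇒id *-comm *-identityˡ
      ; distrib    = comm∧distrˡ⇒distr (IsAbelianGroup.∙-cong +-isAbelianGroup) *-comm *-distribˡ-+
      }
    ; *-comm = *-comm
    }
    where
    open import Algebra.Consequences.Setoid ℂ-setoid

ℂ-commutativeRing : CommutativeRing 0ℓ 0ℓ
ℂ-commutativeRing = record { isCommutativeRing = ℂ-isCommutativeRing }

ℂ-ring : Ring 0ℓ 0ℓ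
ℂ-ring = CommutativeRing.ring ℂ-commutativeRing

VectorSpace : Set₁
VectorSpace = LeftModule ℂ-ring 0ℓ 0ℓ

module _ (V : VectorSpace) where
  open LeftModule V

  -- Linear in the second argument, hence conjugate-linear in the first.
  record IsInnerProduct (⟨_∣_⟩ : Carrierᴹ → Carrierᴹ → ℂ) : Set where
    field
      ⟨⟩-cong     : ∀ {u u′ v v′} → u ≈ᴹ u′ → v ≈ᴹ v′ → ⟨ u ∣ v ⟩ ≈ ⟨ u′ ∣ v′ ⟩
      additiveʳ   : ∀ u v w → ⟨ u ∣ v +ᴹ w ⟩ ≈ ⟨ u ∣ v ⟩ + ⟨ u ∣ w ⟩
      homogeneous : ∀ z u v → ⟨ u ∣ z *ₗ v ⟩ ≈ z * ⟨ u ∣ v ⟩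
      hermitian   : ∀ u v → ⟨ v ∣ u ⟩ ≈ conj ⟨ u ∣ v ⟩
      nonNegative : ∀ v → 0ᴿ ≤ᴿ re ⟨ v ∣ v ⟩
      definite    : ∀ v → ⟨ v ∣ v ⟩ ≈ 0ᶜ → v ≈ᴹ 0ᴹ

  module _ (⟨_∣_⟩ : Carrierᴹ → Carrierᴹ → ℂ) where

    -- ‖ v ‖ ≤ ε for ε > 0, stated as ‖ v ‖² ≤ ε².
    NormAtMost : Carrierᴹ → ℚ → Set
    NormAtMost v ε = re ⟨ v ∣ v ⟩ ≤ᴿ ratio (ε ℚ.* ε)

    CauchySequence : (ℕ → Carrierᴹ) → Set
    CauchySequence v = ∀ ε → 0ℚ ℚ.< ε → ∃[ N ] ∀ m n → N ℕ.≤ m → N ℕ.≤ n →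
                       NormAtMost (v m +ᴹ -ᴹ v n) ε

    ConvergesTo : (ℕ → Carrierᴹ) → Carrierᴹ → Set
    ConvergesTo v l = ∀ ε → 0ℚ ℚ.< ε → ∃[ N ] ∀ n → N ℕ.≤ n → NormAtMost (v n +ᴹ -ᴹ l) ε

  record IsHilbertSpace (⟨_∣_⟩ : Carrierᴹ → Carrierᴹ → ℂ) : Set where
    field
      isInnerProduct : IsInnerProduct ⟨_∣_⟩
      complete       : ∀ v → CauchySequence ⟨_∣_⟩ v → ∃[ l ] ConvergesTo ⟨_∣_⟩ v l

  open Algebra.Definitions _≈ᴹ_
  open Algebra.Structures _≈ᴹ_

  record IsUnitalAlgebra (_·_ : Op₂ Carrierᴹ) (e : Carrierᴹ) : Set where
    field
      isMonoid : IsMonoid _·_ e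
      distrib  : _·_ DistributesOver _+ᴹ_
      *ₗ-·ˡ    : ∀ z u v → (z *ₗ u) · v ≈ᴹ z *ₗ (u · v)
      *ₗ-·ʳ    : ∀ z u v → u · (z *ₗ v) ≈ᴹ z *ₗ (u · v)

  record IsAntilinear (f : Op₁ Carrierᴹ) : Set where
    field
      f-cong      : Congruent₁ f
      additive    : ∀ u v → f (u +ᴹ v) ≈ᴹ f u +ᴹ f v
      conjugating : ∀ z v → f (z *ₗ v) ≈ᴹ conj z *ₗ f v

  record IsHStarAlgebra (⟨_∣_⟩ : Carrierᴹ → Carrierᴹ → ℂ)
                        (_·_ : Op₂ Carrierᴹ) (e : Carrierᴹ) : Set where
    infix 9 _†
    field
      isHilbertSpace  : IsHilbertSpace ⟨_∣_⟩
      isUnitalAlgebra : IsUnitalAlgebra _·_ e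
      _†              : Op₁ Carrierᴹ
      †-antilinear    : IsAntilinear _†
      †-involutive    : Involutive _†
      adjointˡ        : ∀ a b c → ⟨ a · b ∣ c ⟩ ≈ ⟨ b ∣ (a †) · c ⟩
      adjointʳ        : ∀ a b c → ⟨ a · b ∣ c ⟩ ≈ ⟨ a ∣ c · (b †) ⟩

open import Algebra.Properties.Monoid.Sum (CommutativeRing.+-monoid ℂ-commutativeRing) public
  using (sum; sum-syntax)

ℂ^_ : ℕ → VectorSpace
ℂ^ k = record
  { Carrierᴹ = Vector ℂ k
  ; _≈ᴹ_     = λ u v → ∀ i → u i ≈ v i
  ; _+ᴹ_     = λ u v i → u i + v i
  ; _*ₗ_     = λ z v i → z * v i
  ; 0ᴹ       = λ _ → 0ᶜ
  ; -ᴹ_      = λ v i → - v i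
  ; isLeftModule = record
    { isLeftSemimodule = record
      { +ᴹ-isCommutativeMonoid = record
        { isMonoid = record
          { isSemigroup = record
            { isMagma = record
              { isEquivalence = record
                { refl  = λ _ → C.refl
                ; sym   = λ p i → C.sym (p i)
                ; trans = λ p q i → C.trans (p i) (q i)
                }
              ; ∙-cong = λ p q i → C.+-cong (p i) (q i)
              }
            ; assoc = λ u v w i → C.+-assoc (u i) (v i) (w i)
            }
          ; identity = (λ v i → C.+-identityˡ (v i)) , (λ v i → C.+-identityʳ (v i))
          }
        ; comm = λ u v i → C.+-comm (u i) (v i)
        }
      ; isPreleftSemimodule = record
        { *ₗ-cong      = λ p q i → C.*-cong p (q i)
        ; *ₗ-zeroˡ     = λ v i → C.zeroˡ (v i)
        ; *ₗ-distribʳ  = λ v z w i → C.distribʳ (v i) z w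
        ; *ₗ-identityˡ = λ v i → C.*-identityˡ (v i)
        ; *ₗ-assoc     = λ z w v i → C.*-assoc z w (v i)
        ; *ₗ-zeroʳ     = λ z i → C.zeroʳ z
        ; *ₗ-distribˡ  = λ z u v i → C.distribˡ z (u i) (v i)
        }
      }
    ; -ᴹ‿cong    = λ p i → C.-‿cong (p i)
    ; -ᴹ‿inverse = (λ v i → C.-‿inverseˡ (v i)) , (λ v i → C.-‿inverseʳ (v i))
    }
  }
  where module C = CommutativeRing ℂ-commutativeRing

standardInnerProduct : ∀ {k} → Vector ℂ k → Vector ℂ k → ℂ
standardInnerProduct {k} u v = ∑[ i < k ] (conj (u i) * v i)

-- The product with basis i · basis j = Σₗ M i j l · basis l, extended bilinearly.
bilinear : ∀ {k} → (Fin k → Fin k → Fin k → ℝ) → Op₂ (Vector ℂ k)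
bilinear {k} M u v l = ∑[ i < k ] ∑[ j < k ] (u i * v j * real (M i j l))

count-nonZero : ∀ {n k} {P : Pred (Fin n) 0ℓ} (P? : Decidable P) (f : Fin k → Fin n) →
                ∀ i → P (f i) → ℕ.NonZero (count P? (tabulate f))
count-nonZero P? f zero p with P? (f zero)
... | yes _ = _
... | no ¬p = contradiction p ¬p
count-nonZero P? f (suc i) p with P? (f zero)
... | yes _ = _
... | no  _ = count-nonZero P? (f ∘ suc) i p

-- A configuration on X = Fin n with S = Fin r: the partition of X × X is given
-- by the surjection taking a pair to its block, so (x , y) lies in c when
-- block x y ≡ c.
record CoherentConfiguration (n r : ℕ) : Set where
  field
    block    : Fin n → Fin n → Fin r
    nonempty : ∀ c → ∃₂ λ x y → block x y ≡ c

  IsDiagonal : Fin r → Set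
  IsDiagonal p = ∀ x y → block x y ≡ p → x ≡ y

  paths : (a b : Fin r) (x y : Fin n) → ℕ
  paths a b x y = count (λ z → (block x z Fin.≟ a) ×-dec (block z y Fin.≟ b)) (allFin n)

  field
    diagonal : ∀ p x → block x x ≡ p → IsDiagonal p
    coherent : ∀ a b c → ∃[ k ] ∀ x y → block x y ≡ c → paths a b x y ≡ k
    converse : ∀ c → ∃[ c′ ] ∀ x y → block x y ≡ c′ ⇔ block y x ≡ c

  ∇ : (a b c : Fin r) → ℕ
  ∇ a b c = proj₁ (coherent a b c)

  outdegree : Fin r → Fin n → ℕ
  outdegree a x = count (λ y → block x y Fin.≟ a) (allFin n)

  -- The outdegree at the source of any chosen pair in the block; coherence makes
  -- it independent of the pair.
  ∥_∥ : Fin r → ℕ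
  ∥ a ∥ = outdegree a (proj₁ (nonempty a))

  cardinality : Fin r → ℕ
  cardinality p = count (λ xy → block (proj₁ xy) (proj₂ xy) Fin.≟ p) (allPairs (allFin n) (allFin n))

  IsHalfHomogeneous : Set
  IsHalfHomogeneous = ∀ p q → IsDiagonal p → IsDiagonal q → cardinality p ≡ cardinality q

  isDiagonal? : Decidable IsDiagonal
  isDiagonal? p = Fin.all? λ x → Fin.all? λ y → (block x y Fin.≟ p) →-dec (x Fin.≟ y)

  ∥∥-nonZero : ∀ a → ℕ.NonZero ∥ a ∥
  ∥∥-nonZero a = let (x , y , xy∈a) = nonempty a in
    count-nonZero (λ z → block x z Fin.≟ a) id y xy∈a

  ∇• : (a b c : Fin r) → ℝ
  ∇• a b c = √[ ∥ c ∥ / ∥ a ∥ ℕ.* ∥ b ∥ ] {{ℕ.m*n≢0 ∥ a ∥ ∥ b ∥ {{∥∥-nonZero a}} {{∥∥-nonZero b}}}} *ᴿ fromℕ (∇ a b c)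

  L[∇•] : Op₂ (Vector ℂ r)
  L[∇•] = bilinear ∇•

  L[e] : Vector ℂ r
  L[e] p = if does (isDiagonal? p) then 1ᶜ else 0ᶜ

{-# OPTIONS --safe #-}
module Submission where

-- Rescale u ∈ L(S) by û c = u c / √∥c∥ and let Φ u be the matrix with entries
-- Φ u x y = û (block x y).  The roots in ∇• are exactly what makes Φ turn the product of
-- L(S) into matrix multiplication and L(e) into the identity matrix, and Φ is injective
-- because blocks are non-empty.  Half-homogeneity enters twice: if all diagonal blocks have
-- N points, then every block c has N ∥c∥ pairs, so that ∥c⁻¹∥ = ∥c∥ and
-- N ⟨ u ∣ v ⟩ = tr (Φ u ᴴ Φ v).  Hence the conjugate transpose of Φ u is Φ of
-- u† c = conj (u c⁻¹), and the adjoint laws are those of the trace form on matrices.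

open import Algebra.Bundles using (CommutativeRing; CommutativeSemiring)
open import Algebra.Core using (Op₁; Op₂)
open import Algebra.Module.Bundles using (LeftModule)
open import Algebra.Morphism.Structures using (module SemiringMorphisms)
import Algebra.Properties.CommutativeSemigroup as CommutativeSemigroupProperties
import Algebra.Properties.Semiring.Mult as Mult
import Algebra.Properties.Semiring.Sum as Sum
open import Data.Bool.Base using (true; false; if_then_else_)
open import Data.Fin.Base using (Fin; zero; suc)
import Data.Fin.Properties as Fin
open import Data.Integer.Base as ℤ using (+_)
import Data.Integer.Properties as ℤ
open import Data.Nat.Base as ℕ using (ℕ; zero; suc; NonZero)
import Data.Nat.Properties as ℕ
open import Data.Nat.Solver using () renaming (module +-*-Solver to ℕ-Solver)
open import Data.Product.Base using (∃-syntax; _×_; _,_; proj₁; proj₂)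
open import Data.Rational.Base as ℚ using (ℚ; 0ℚ; 1ℚ; ½)
import Data.Rational.Properties as ℚ
open import Data.Rational.Solver using () renaming (module +-*-Solver to ℚ-Solver)
open import Data.Rational.Unnormalised.Base as ℚᵘ using (mkℚᵘ)
import Data.Rational.Unnormalised.Properties as ℚᵘ
open import Data.Sum.Base using (inj₁; inj₂)
open import Data.Vec.Base as Vec using (Vec; allFin; allPairs; count; tabulate)
open import Data.Vec.Functional using (Vector)
open import Function.Base using (_∘_; id)
open import Function.Bundles using (_⇔_; mk⇔; Equivalence)
open import Level using (0ℓ)
open import Relation.Binary.PropositionalEquality as ≡ using (_≡_; cong)
import Relation.Binary.Reasoning.Setoid as SetoidReasoning
open import Relation.Nullary.Decidable using (Dec; does; yes; no; _×-dec_; does-⇔; dec-true; dec-false)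
open import Relation.Nullary.Negation using (¬_; contradiction)
open import Relation.Unary using (Pred; Decidable)
open import Defs using (CoherentConfiguration; count-nonZero)

-- Counting and matrices over a commutative semiring

-- Roots in ℝ are Cauchy sequences of integer approximations, awkward to calculate with. The algebra
-- is therefore done over any commutative semiring `K` with a conjugation and elements `1/√ m`
-- subject to m (1/√ m)² = 1; there √m can be written as m · 1/√ m. The price is one analytic fact,
-- that √(l / (i j)) splits over the three valencies, and it is obtained by comparing squares of
-- non-negative reals. Taking `K` to be ℕ, the same summation lemmas count pairs and points. The
-- trace form exceeds the inner product by the factor N. Both sides of an adjoint law carry this
-- factor, so it does no harm, provided that it is the same for every block; with fibres of
-- different sizes the coordinates of L(S) would be weighted unevenly.

count-cong : ∀ {n k} {P Q : Pred (Fin n) 0ℓ} (P? : Decidable P) (Q? : Decidable Q) (f : Fin k → Fin n) →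
             (∀ i → P i ⇔ Q i) → count P? (tabulate f) ≡ count Q? (tabulate f)
count-cong {k = zero}  P? Q? f P⇔Q = ≡.refl
count-cong {k = suc k} P? Q? f P⇔Q
  with does (P? (f zero)) | does (Q? (f zero)) | does-⇔ (P⇔Q (f zero)) (P? (f zero)) (Q? (f zero))
... | true  | _ | ≡.refl = cong suc (count-cong P? Q? (f ∘ suc) P⇔Q)
... | false | _ | ≡.refl = count-cong P? Q? (f ∘ suc) P⇔Q

count-none : ∀ {n k} {P : Pred (Fin n) 0ℓ} (P? : Decidable P) (f : Fin k → Fin n) →
             (∀ i → ¬ P i) → count P? (tabulate f) ≡ 0
count-none {k = zero}  P? f ¬P = ≡.refl
count-none {k = suc k} P? f ¬P with P? (f zero)
... | yes p = contradiction p (¬P (f zero))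
... | no  _ = count-none P? (f ∘ suc) ¬P

module Indicators {c ℓ} (K : CommutativeSemiring c ℓ) where
  open CommutativeSemiring K hiding (zero)
  open Sum semiring
  open Mult semiring using () renaming (_×_ to _⋅_)
  open SetoidReasoning setoid

  ⟦_⟧ : ∀ {p} {P : Set p} → Dec P → Carrier
  ⟦ P? ⟧ = if does P? then 1# else 0#

  ⟦⟧-cong : ∀ {p q} {P : Set p} {Q : Set q} (P? : Dec P) (Q? : Dec Q) → P ⇔ Q → ⟦ P? ⟧ ≈ ⟦ Q? ⟧
  ⟦⟧-cong P? Q? P⇔Q = reflexive (cong (if_then 1# else 0#) (does-⇔ P⇔Q P? Q?))

  ⟦⟧-true : ∀ {p} {P : Set p} (P? : Dec P) → P → ⟦ P? ⟧ ≈ 1#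
  ⟦⟧-true P? p = reflexive (cong (if_then 1# else 0#) (dec-true P? p))

  ⟦⟧-false : ∀ {p} {P : Set p} (P? : Dec P) → ¬ P → ⟦ P? ⟧ ≈ 0#
  ⟦⟧-false P? ¬p = reflexive (cong (if_then 1# else 0#) (dec-false P? ¬p))

  ⟦⟧-× : ∀ {p q} {P : Set p} {Q : Set q} (P? : Dec P) (Q? : Dec Q) → ⟦ P? ×-dec Q? ⟧ ≈ ⟦ P? ⟧ * ⟦ Q? ⟧
  ⟦⟧-× P? Q? with does P?
  ... | true  = sym (*-identityˡ _)
  ... | false = sym (zeroˡ _)

  ∑-cong : ∀ n {f g : Vector Carrier n} → (∀ i → f i ≈ g i) → sum f ≈ sum g
  ∑-cong n = sum-cong-≋ {n}

  ∑-distribˡ-* : ∀ n x {f : Vector Carrier n} → x * sum f ≈ ∑[ i < n ] (x * f i)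
  ∑-distribˡ-* n x = *-distribˡ-sum {n} x _

  ∑-distribʳ-* : ∀ n x {f : Vector Carrier n} → sum f * x ≈ ∑[ i < n ] (f i * x)
  ∑-distribʳ-* n x = *-distribʳ-sum {n} x _

  sum-zero : ∀ {n} (f : Vector Carrier n) → (∀ i → f i ≈ 0#) → sum f ≈ 0#
  sum-zero {n} f f≈0 = trans (sum-cong-≋ f≈0) (sum-replicate-zero n)

  sum-δ : ∀ {n} (i : Fin n) (f : Vector Carrier n) → ∑[ j < n ] (⟦ i Fin.≟ j ⟧ * f j) ≈ f i
  sum-δ {suc n} zero f = begin
    1# * f zero + ∑[ j < n ] (0# * f (suc j)) ≈⟨ +-cong (*-identityˡ _) (sum-zero {n} _ λ j → zeroˡ _) ⟩
    f zero + 0#                               ≈⟨ +-identityʳ _ ⟩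
    f zero                                    ∎
  sum-δ {suc n} (suc i) f = begin
    0# * f zero + ∑[ j < n ] (⟦ i Fin.≟ j ⟧ * f (suc j)) ≈⟨ +-cong (zeroˡ _) (sum-δ i (f ∘ suc)) ⟩
    0# + f (suc i)                                       ≈⟨ +-identityˡ _ ⟩
    f (suc i)                                            ∎

  -- The bridge from counts to algebra: `m ⋅ 1#` is the image of the number m in `K`, and every ∇,
  -- valency and cardinality enters later calculations in this form.
  count-sum : ∀ {a k} {A : Set a} {P : Pred A 0ℓ} (P? : Decidable P) (f : Fin k → A) →
              count P? (tabulate f) ⋅ 1# ≈ ∑[ i < k ] ⟦ P? (f i) ⟧
  count-sum {k = zero}  P? f = refl
  count-sum {k = suc k} P? f with does (P? (f zero))
  ... | true  = +-congˡ (count-sum P? (f ∘ suc))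
  ... | false = trans (count-sum P? (f ∘ suc)) (sym (+-identityˡ _))

  private
    -- `allPairs` unfolds to the row of the first element followed by the pairs of the others. The
    -- tail `ys` stays one undivided count, to which the recursion in `count-allPairs` applies.
    count-map-++ : ∀ {a b k m} {A : Set a} {B : Set b} {P : Pred B 0ℓ} (P? : Decidable P)
                   (g : A → B) (f : Fin k → A) (ys : Vec B m) →
                   count P? (Vec.map g (tabulate f) Vec.++ ys) ⋅ 1# ≈
                   ∑[ i < k ] ⟦ P? (g (f i)) ⟧ + count P? ys ⋅ 1#
    count-map-++ {k = zero}  P? g f ys = sym (+-identityˡ _)
    count-map-++ {k = suc k} P? g f ys with does (P? (g (f zero)))
    ... | true  = trans (+-congˡ (count-map-++ P? g (f ∘ suc) ys)) (sym (+-assoc _ _ _))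
    ... | false = trans (count-map-++ P? g (f ∘ suc) ys) (+-congʳ (sym (+-identityˡ _)))

  count-allPairs : ∀ {a k m} {A B : Set a} {P : Pred (A × B) 0ℓ} (P? : Decidable P)
                   (f : Fin k → A) (g : Fin m → B) →
                   count P? (allPairs (tabulate f) (tabulate g)) ⋅ 1# ≈
                   ∑[ i < k ] ∑[ j < m ] ⟦ P? (f i , g j) ⟧
  count-allPairs {k = zero}  P? f g = refl
  count-allPairs {k = suc k} P? f g = begin
    count P? (allPairs (tabulate f) (tabulate g)) ⋅ 1#
      ≈⟨ count-map-++ P? (f zero ,_) g (allPairs (tabulate (f ∘ suc)) (tabulate g)) ⟩
    ∑[ j < _ ] ⟦ P? (f zero , g j) ⟧ + count P? (allPairs (tabulate (f ∘ suc)) (tabulate g)) ⋅ 1#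
      ≈⟨ +-congˡ (count-allPairs P? (f ∘ suc) g) ⟩
    ∑[ j < _ ] ⟦ P? (f zero , g j) ⟧ + ∑[ i < k ] ∑[ j < _ ] ⟦ P? (f (suc i) , g j) ⟧ ∎

module Matrices {c ℓ} (K : CommutativeSemiring c ℓ) where
  open CommutativeSemiring K hiding (zero)
  open Sum semiring
  open Indicators K
  open SetoidReasoning setoid
  open SemiringMorphisms rawSemiring rawSemiring using (IsSemiringHomomorphism)
  open CommutativeSemigroupProperties *-commutativeSemigroup using (xy∙z≈y∙xz)

  Matrix : ℕ → Set c
  Matrix n = Fin n → Fin n → Carrier

  infixl 7 _⊗_
  _⊗_ : ∀ {n} → Op₂ (Matrix n)
  (A ⊗ B) x y = ∑[ z < _ ] (A x z * B z y)

  𝟙 : ∀ {n} → Matrix n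
  𝟙 x y = ⟦ x Fin.≟ y ⟧

  ⊗-congˡ : ∀ {n} (A : Matrix n) {B B′ : Matrix n} → (∀ x y → B x y ≈ B′ x y) →
            ∀ x y → (A ⊗ B) x y ≈ (A ⊗ B′) x y
  ⊗-congˡ {n} A B≈B′ x y = ∑-cong n λ z → *-congˡ (B≈B′ z y)

  ⊗-congʳ : ∀ {n} (B : Matrix n) {A A′ : Matrix n} → (∀ x y → A x y ≈ A′ x y) →
            ∀ x y → (A ⊗ B) x y ≈ (A′ ⊗ B) x y
  ⊗-congʳ {n} B A≈A′ x y = ∑-cong n λ z → *-congʳ (A≈A′ x z)

  ⊗-assoc : ∀ {n} (A B C : Matrix n) x y → ((A ⊗ B) ⊗ C) x y ≈ (A ⊗ (B ⊗ C)) x y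
  ⊗-assoc {n} A B C x y = begin
    ∑[ w < n ] (∑[ z < n ] (A x z * B z w) * C w y)
      ≈⟨ ∑-cong n (λ w → trans (∑-distribʳ-* n (C w y)) (∑-cong n λ z → *-assoc _ _ _)) ⟩
    ∑[ w < n ] ∑[ z < n ] (A x z * (B z w * C w y))
      ≈⟨ ∑-comm (λ w z → A x z * (B z w * C w y)) ⟩
    ∑[ z < n ] ∑[ w < n ] (A x z * (B z w * C w y))
      ≈⟨ ∑-cong n (λ z → ∑-distribˡ-* n (A x z)) ⟨
    ∑[ z < n ] (A x z * ∑[ w < n ] (B z w * C w y)) ∎

  ⊗-identityˡ : ∀ {n} (A : Matrix n) x y → (𝟙 ⊗ A) x y ≈ A x y
  ⊗-identityˡ A x y = sum-δ x (λ z → A z y)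

  ⊗-identityʳ : ∀ {n} (A : Matrix n) x y → (A ⊗ 𝟙) x y ≈ A x y
  ⊗-identityʳ {n} A x y = begin
    ∑[ z < n ] (A x z * ⟦ z Fin.≟ y ⟧)
      ≈⟨ ∑-cong n (λ z → trans (*-comm _ _) (*-congʳ (⟦⟧-cong (z Fin.≟ y) (y Fin.≟ z) (mk⇔ ≡.sym ≡.sym)))) ⟩
    ∑[ z < n ] (⟦ y Fin.≟ z ⟧ * A x z)
      ≈⟨ sum-δ y (A x) ⟩
    A x y ∎

  module Adjoint {_⋆ : Op₁ Carrier} (⋆-homo : IsSemiringHomomorphism _⋆) where
    open IsSemiringHomomorphism ⋆-homo public
      renaming (⟦⟧-cong to ⋆-cong; +-homo to ⋆-+; *-homo to ⋆-*; 0#-homo to ⋆-0#; 1#-homo to ⋆-1#) using ()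

    infix 8 _ᴴ
    _ᴴ : ∀ {n} → Op₁ (Matrix n)
    (A ᴴ) x y = (A y x) ⋆

    -- The trace form tr (A ᴴ B).
    ⟪_,_⟫ : ∀ {n} → Matrix n → Matrix n → Carrier
    ⟪ A , B ⟫ = ∑[ x < _ ] ∑[ y < _ ] (A x y ⋆ * B x y)

    ⟪⟫-congˡ : ∀ {n} (A : Matrix n) {B B′ : Matrix n} → (∀ x y → B x y ≈ B′ x y) → ⟪ A , B ⟫ ≈ ⟪ A , B′ ⟫
    ⟪⟫-congˡ {n} A B≈B′ = ∑-cong n λ x → ∑-cong n λ y → *-congˡ (B≈B′ x y)

    ⟪⟫-congʳ : ∀ {n} (B : Matrix n) {A A′ : Matrix n} → (∀ x y → A x y ≈ A′ x y) → ⟪ A , B ⟫ ≈ ⟪ A′ , B ⟫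
    ⟪⟫-congʳ {n} B A≈A′ = ∑-cong n λ x → ∑-cong n λ y → *-congʳ (⋆-cong (A≈A′ x y))

    ⋆-sum : ∀ {n} (f : Vector Carrier n) → (sum f) ⋆ ≈ ∑[ i < n ] (f i ⋆)
    ⋆-sum {zero}  f = ⋆-0#
    ⋆-sum {suc n} f = trans (⋆-+ _ _) (+-congˡ (⋆-sum (f ∘ suc)))

    private
      expand : ∀ {n} (A B C : Matrix n) →
               ⟪ A ⊗ B , C ⟫ ≈ ∑[ x < n ] ∑[ y < n ] ∑[ z < n ] ((A x z ⋆ * B z y ⋆) * C x y)
      expand {n} A B C = ∑-cong n λ x → ∑-cong n λ y →
        trans (*-congʳ (trans (⋆-sum {n} _) (∑-cong n λ z → ⋆-* _ _))) (∑-distribʳ-* n (C x y))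

    -- Both sides are one triple sum in different orders. The row index x of `C` must become the
    -- innermost one, being summed over inside `A ᴴ ⊗ C`, and z the outermost; three exchanges of
    -- neighbouring sums achieve this.
    ⟪⟫-adjointˡ : ∀ {n} (A B C : Matrix n) → ⟪ A ⊗ B , C ⟫ ≈ ⟪ B , A ᴴ ⊗ C ⟫
    ⟪⟫-adjointˡ {n} A B C = begin
      ⟪ A ⊗ B , C ⟫
        ≈⟨ expand A B C ⟩
      ∑[ x < n ] ∑[ y < n ] ∑[ z < n ] ((A x z ⋆ * B z y ⋆) * C x y)
        ≈⟨ ∑-cong n (λ x → ∑-cong n λ y → ∑-cong n λ z → xy∙z≈y∙xz _ _ _) ⟩
      ∑[ x < n ] ∑[ y < n ] ∑[ z < n ] (B z y ⋆ * (A x z ⋆ * C x y))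
        ≈⟨ ∑-cong n (λ x → ∑-comm (λ y z → B z y ⋆ * (A x z ⋆ * C x y))) ⟩
      ∑[ x < n ] ∑[ z < n ] ∑[ y < n ] (B z y ⋆ * (A x z ⋆ * C x y))
        ≈⟨ ∑-comm (λ x z → ∑[ y < n ] (B z y ⋆ * (A x z ⋆ * C x y))) ⟩
      ∑[ z < n ] ∑[ x < n ] ∑[ y < n ] (B z y ⋆ * (A x z ⋆ * C x y))
        ≈⟨ ∑-cong n (λ z → ∑-comm (λ x y → B z y ⋆ * (A x z ⋆ * C x y))) ⟩
      ∑[ z < n ] ∑[ y < n ] ∑[ x < n ] (B z y ⋆ * (A x z ⋆ * C x y))
        ≈⟨ ∑-cong n (λ z → ∑-cong n λ y → ∑-distribˡ-* n (B z y ⋆)) ⟨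
      ⟪ B , A ᴴ ⊗ C ⟫ ∎

    ⟪⟫-adjointʳ : ∀ {n} (A B C : Matrix n) → ⟪ A ⊗ B , C ⟫ ≈ ⟪ A , C ⊗ B ᴴ ⟫
    ⟪⟫-adjointʳ {n} A B C = begin
      ⟪ A ⊗ B , C ⟫
        ≈⟨ expand A B C ⟩
      ∑[ x < n ] ∑[ y < n ] ∑[ z < n ] ((A x z ⋆ * B z y ⋆) * C x y)
        ≈⟨ ∑-cong n (λ x → ∑-cong n λ y → ∑-cong n λ z → trans (*-assoc _ _ _) (*-congˡ (*-comm _ _))) ⟩
      ∑[ x < n ] ∑[ y < n ] ∑[ z < n ] (A x z ⋆ * (C x y * B z y ⋆))
        ≈⟨ ∑-cong n (λ x → ∑-comm (λ y z → A x z ⋆ * (C x y * B z y ⋆))) ⟩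
      ∑[ x < n ] ∑[ z < n ] ∑[ y < n ] (A x z ⋆ * (C x y * B z y ⋆))
        ≈⟨ ∑-cong n (λ x → ∑-cong n λ z → ∑-distribˡ-* n (A x z ⋆)) ⟨
      ⟪ A , C ⊗ B ᴴ ⟫ ∎

-- Coherent configurations

module Valencies {n r : ℕ} (𝒮 : CoherentConfiguration n r) where
  open CoherentConfiguration 𝒮
  open Sum ℕ.+-*-semiring
  open Mult ℕ.+-*-semiring using () renaming (_×_ to _⋅_)
  open Indicators ℕ.+-*-commutativeSemiring
  open ≡.≡-Reasoning

  ⋅1-identity : ∀ m → m ⋅ 1 ≡ m
  ⋅1-identity zero    = ≡.refl
  ⋅1-identity (suc m) = cong suc (⋅1-identity m)

  count≡sum : ∀ {k} {P : Pred (Fin k) 0ℓ} (P? : Decidable P) → count P? (allFin k) ≡ ∑[ i < k ] ⟦ P? i ⟧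
  count≡sum P? = ≡.trans (≡.sym (⋅1-identity _)) (count-sum P? id)

  source : Fin r → Fin r
  source c = let x = proj₁ (nonempty c) in block x x

  -- Otherwise x → x → y is a path of type (block x x , block x y), while no path of
  -- that type joins x′ to y′: its first step, lying in a diagonal block, would be a loop
  -- at x′ and so put x′ in the block of x.
  block-determines-source : ∀ {x y x′ y′} → block x y ≡ block x′ y′ → block x x ≡ block x′ x′
  block-determines-source {x} {y} {x′} {y′} eq with block x′ x′ Fin.≟ block x x
  ... | yes p = ≡.sym p
  ... | no ¬p = contradiction 0≡paths (≡.≢-sym (ℕ.≢-nonZero⁻¹ _ {{paths≢0}}))
    where
    edge? : ∀ u v → Decidable (λ z → block u z ≡ block x x × block z v ≡ block x y)
    edge? u v z = (block u z Fin.≟ block x x) ×-dec (block z v Fin.≟ block x y)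
    paths≢0 : NonZero (paths (block x x) (block x y) x y)
    paths≢0 = count-nonZero (edge? x y) id x (≡.refl , ≡.refl)
    0≡paths : 0 ≡ paths (block x x) (block x y) x y
    0≡paths = begin
      0
        ≡⟨ count-none (edge? x′ y′) id (λ z (p , _) → ¬p
             (≡.trans (cong (block x′) (diagonal (block x x) x ≡.refl x′ z p)) p)) ⟨
      paths (block x x) (block x y) x′ y′
        ≡⟨ proj₂ (coherent (block x x) (block x y) (block x y)) x′ y′ (≡.sym eq) ⟩
      ∇ (block x x) (block x y) (block x y)
        ≡⟨ proj₂ (coherent (block x x) (block x y) (block x y)) x y ≡.refl ⟨
      paths (block x x) (block x y) x y ∎

  source-block : ∀ x y → source (block x y) ≡ block x x
  source-block x y = block-determines-source (proj₂ (proj₂ (nonempty (block x y))))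

  source-idem : ∀ c → source (source c) ≡ source c
  source-idem c = source-block _ _

  source-isDiagonal : ∀ c → IsDiagonal (source c)
  source-isDiagonal c = diagonal (source c) _ ≡.refl

  conv : Fin r → Fin r
  conv c = proj₁ (converse c)

  conv-block : ∀ x y → conv (block x y) ≡ block y x
  conv-block x y = ≡.sym (Equivalence.from (proj₂ (converse (block x y)) y x) ≡.refl)

  conv-involutive : ∀ c → conv (conv c) ≡ c
  conv-involutive c with nonempty c
  ... | x , y , ≡.refl = ≡.trans (cong conv (conv-block x y)) (conv-block y x)

  -- Every step x → z in `a` closes up to a path x → z → x through the converse block. An outdegree
  -- thus becomes a path count at the pair (x , x), and coherence applies to it.
  outdegree-paths : ∀ a x → outdegree a x ≡ paths a (conv a) x x
  outdegree-paths a x = count-cong (λ z → block x z Fin.≟ a) _ id λ z →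
    mk⇔ (λ p → p , Equivalence.from (proj₂ (converse a) z x) p) proj₁

  outdegree-cong : ∀ a {x x′} → block x x ≡ block x′ x′ → outdegree a x ≡ outdegree a x′
  outdegree-cong a {x} {x′} eq = begin
    outdegree a x              ≡⟨ outdegree-paths a x ⟩
    paths a (conv a) x x       ≡⟨ proj₂ (coherent a (conv a) (block x′ x′)) x x eq ⟩
    ∇ a (conv a) (block x′ x′) ≡⟨ proj₂ (coherent a (conv a) (block x′ x′)) x′ x′ ≡.refl ⟨
    paths a (conv a) x′ x′     ≡⟨ outdegree-paths a x′ ⟨
    outdegree a x′             ∎

  outdegree≡δ : ∀ a x → outdegree a x ≡ ⟦ block x x Fin.≟ source a ⟧ ℕ.* ∥ a ∥
  outdegree≡δ a x with block x x Fin.≟ source a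
  ... | yes p = ≡.trans (outdegree-cong a p) (≡.sym (ℕ.+-identityʳ ∥ a ∥))
  ... | no ¬p = count-none (λ y → block x y Fin.≟ a) id λ y xy∈a →
        ¬p (≡.trans (≡.sym (source-block x y)) (cong source xy∈a))

  ∥diagonal∥ : ∀ p → IsDiagonal p → ∥ p ∥ ≡ 1
  ∥diagonal∥ p p-diagonal with nonempty p
  ... | x , y , ≡.refl = begin
    outdegree p x                     ≡⟨ count-cong (λ z → block x z Fin.≟ p) (x Fin.≟_) id same ⟩
    count (x Fin.≟_) (allFin n)       ≡⟨ count≡sum (x Fin.≟_) ⟩
    ∑[ z < n ] ⟦ x Fin.≟ z ⟧          ≡⟨ ∑-cong n (λ z → ℕ.*-identityʳ _) ⟨
    ∑[ z < n ] (⟦ x Fin.≟ z ⟧ ℕ.* 1)  ≡⟨ sum-δ x (λ _ → 1) ⟩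
    1                                 ∎
    where
    same : ∀ z → block x z ≡ block x y ⇔ x ≡ z
    same z = mk⇔ (p-diagonal x z) λ { ≡.refl → cong (block x) (p-diagonal x y ≡.refl) }

  cardinality-sum : ∀ c → cardinality c ≡ ∑[ x < n ] ∑[ y < n ] ⟦ block x y Fin.≟ c ⟧
  cardinality-sum c = ≡.trans (≡.sym (⋅1-identity _))
    (count-allPairs (λ xy → block (proj₁ xy) (proj₂ xy) Fin.≟ c) id id)

  points : Fin r → ℕ
  points p = count (λ x → block x x Fin.≟ p) (allFin n)

  -- The pairs are counted by first coordinate: a point of the source fibre starts `∥ c ∥` of them,
  -- any other point none.
  cardinality≡points*∥∥ : ∀ c → cardinality c ≡ points (source c) ℕ.* ∥ c ∥
  cardinality≡points*∥∥ c = begin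
    cardinality c
      ≡⟨ cardinality-sum c ⟩
    ∑[ x < n ] ∑[ y < n ] ⟦ block x y Fin.≟ c ⟧
      ≡⟨ ∑-cong n (λ x → count≡sum (λ y → block x y Fin.≟ c)) ⟨
    ∑[ x < n ] outdegree c x
      ≡⟨ ∑-cong n (outdegree≡δ c) ⟩
    ∑[ x < n ] (⟦ block x x Fin.≟ source c ⟧ ℕ.* ∥ c ∥)
      ≡⟨ ∑-distribʳ-* n ∥ c ∥ ⟨
    ∑[ x < n ] ⟦ block x x Fin.≟ source c ⟧ ℕ.* ∥ c ∥
      ≡⟨ cong (ℕ._* ∥ c ∥) (count≡sum (λ x → block x x Fin.≟ source c)) ⟨
    points (source c) ℕ.* ∥ c ∥ ∎

  -- Half-homogeneity compares diagonal blocks as sets of pairs, whereas the factor above counts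
  -- points. The two sizes agree because a diagonal block has valency 1.
  cardinality-source : ∀ c → cardinality (source c) ≡ points (source c)
  cardinality-source c = begin
    cardinality (source c)                           ≡⟨ cardinality≡points*∥∥ (source c) ⟩
    points (source (source c)) ℕ.* ∥ source c ∥
      ≡⟨ ≡.cong₂ (λ p → points p ℕ.*_) (source-idem c) (∥diagonal∥ (source c) (source-isDiagonal c)) ⟩
    points (source c) ℕ.* 1                          ≡⟨ ℕ.*-identityʳ _ ⟩
    points (source c)                                ∎

  points-source-nonZero : ∀ c → NonZero (points (source c))
  points-source-nonZero c =
    count-nonZero (λ x → block x x Fin.≟ source c) id (proj₁ (nonempty c)) ≡.refl

  cardinality-conv : ∀ c → cardinality (conv c) ≡ cardinality c
  cardinality-conv c = begin
    cardinality (conv c)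
      ≡⟨ cardinality-sum (conv c) ⟩
    ∑[ x < n ] ∑[ y < n ] ⟦ block x y Fin.≟ conv c ⟧
      ≡⟨ ∑-comm (λ x y → ⟦ block x y Fin.≟ conv c ⟧) ⟩
    ∑[ y < n ] ∑[ x < n ] ⟦ block x y Fin.≟ conv c ⟧
      ≡⟨ ∑-cong n (λ y → ∑-cong n λ x → ⟦⟧-cong (block x y Fin.≟ conv c) (block y x Fin.≟ c)
           (proj₂ (converse c) x y)) ⟩
    ∑[ y < n ] ∑[ x < n ] ⟦ block y x Fin.≟ c ⟧
      ≡⟨ cardinality-sum c ⟨
    cardinality c ∎

  module _ (½-homogeneous : IsHalfHomogeneous) where

    points-source-const : ∀ c d → points (source c) ≡ points (source d)
    points-source-const c d = begin
      points (source c)      ≡⟨ cardinality-source c ⟨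
      cardinality (source c) ≡⟨ ½-homogeneous _ _ (source-isDiagonal c) (source-isDiagonal d) ⟩
      cardinality (source d) ≡⟨ cardinality-source d ⟩
      points (source d)      ∎

    ∥conv∥ : ∀ c → ∥ conv c ∥ ≡ ∥ c ∥
    ∥conv∥ c = ℕ.*-cancelˡ-≡ _ _ (points (source c)) {{points-source-nonZero c}} (begin
      points (source c) ℕ.* ∥ conv c ∥        ≡⟨ cong (ℕ._* ∥ conv c ∥) (points-source-const c (conv c)) ⟩
      points (source (conv c)) ℕ.* ∥ conv c ∥ ≡⟨ cardinality≡points*∥∥ (conv c) ⟨
      cardinality (conv c)                    ≡⟨ cardinality-conv c ⟩
      cardinality c                           ≡⟨ cardinality≡points*∥∥ c ⟩
      points (source c) ℕ.* ∥ c ∥             ∎)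

    ∃-fibreSize : ∃[ N ] NonZero N × ∀ c → cardinality c ≡ N ℕ.* ∥ c ∥
    ∃-fibreSize with inhabited? r
      where
      inhabited? : ∀ k → Dec (Fin k)
      inhabited? zero    = no λ ()
      inhabited? (suc k) = yes zero
    -- Without blocks any N satisfies the equation vacuously; 1 is a value that is non-zero, as the
    -- later inversion of N demands.
    ... | no ∄c = 1 , _ , λ c → contradiction c ∄c
    ... | yes d = points (source d) , points-source-nonZero d , λ c →
          ≡.trans (cardinality≡points*∥∥ c) (cong (ℕ._* ∥ c ∥) (points-source-const c d))

-- The matrix representation of L(S) over a semiring with roots

module Representation {c ℓ} (K : CommutativeSemiring c ℓ) {n r : ℕ} (𝒮 : CoherentConfiguration n r) where
  open CommutativeSemiring K hiding (zero)
  open CoherentConfiguration 𝒮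
  open Sum semiring
  open Mult semiring using (×1-homo-*) renaming (_×_ to _⋅_)
  open Indicators K
  open Matrices K
  open Valencies 𝒮 using (conv; conv-block; conv-involutive; ∥diagonal∥; ∥conv∥; ∃-fibreSize)
  open SemiringMorphisms rawSemiring rawSemiring using (IsSemiringHomomorphism)
  open CommutativeSemigroupProperties *-commutativeSemigroup
  open SetoidReasoning setoid

  -- A semiring has neither division nor roots, so `1/√` is a parameter. By `1/√-inverse` the
  -- element m · 1/√ m inverts `1/√ m`, which is all that cancelling a root takes.
  module Normalised
    {_⋆ : Op₁ Carrier}
    (⋆-homo : IsSemiringHomomorphism _⋆)
    (⋆-involutive : ∀ x → (x ⋆) ⋆ ≈ x)
    (1/√ : (m : ℕ) .{{_ : NonZero m}} → Carrier)
    (1/√-inverse : ∀ m .{{_ : NonZero m}} → (m ⋅ 1#) * (1/√ m * 1/√ m) ≈ 1#)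
    (1/√-one : 1/√ 1 ≈ 1#)
    (1/√-real : ∀ m .{{_ : NonZero m}} → (1/√ m) ⋆ ≈ 1/√ m)
    (½-homogeneous : IsHalfHomogeneous)
    where

    open Adjoint ⋆-homo

    τ : Fin r → Carrier
    τ a = 1/√ ∥ a ∥ {{∥∥-nonZero a}}

    τ-inverse : ∀ a → ((∥ a ∥ ⋅ 1#) * τ a) * τ a ≈ 1#
    τ-inverse a = trans (*-assoc _ _ _) (1/√-inverse ∥ a ∥ {{∥∥-nonZero a}})

    1/√-cong : ∀ {m m′} .{{_ : NonZero m}} .{{_ : NonZero m′}} → m ≡ m′ → 1/√ m ≈ 1/√ m′
    1/√-cong ≡.refl = refl

    τ-conv : ∀ a → τ (conv a) ≈ τ a
    τ-conv a = 1/√-cong {{∥∥-nonZero (conv a)}} {{∥∥-nonZero a}} (∥conv∥ ½-homogeneous a)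

    τ-diagonal : ∀ p → IsDiagonal p → τ p ≈ 1#
    τ-diagonal p p-diagonal = trans (1/√-cong {{∥∥-nonZero p}} (∥diagonal∥ p p-diagonal)) 1/√-one

    Φ : Vector Carrier r → Matrix n
    Φ u x y = τ (block x y) * u (block x y)

    Φ-injective : ∀ u v → (∀ x y → Φ u x y ≈ Φ v x y) → ∀ i → u i ≈ v i
    Φ-injective u v Φu≈Φv i with nonempty i
    ... | x , y , ≡.refl = begin
      u i           ≈⟨ unscale u ⟨
      s * Φ u x y   ≈⟨ *-congˡ (Φu≈Φv x y) ⟩
      s * Φ v x y   ≈⟨ unscale v ⟩
      v i           ∎
      where
      -- This is √∥i∥, written without division; it undoes the scaling in `Φ`.
      s = (∥ i ∥ ⋅ 1#) * τ i
      unscale : ∀ w → s * Φ w x y ≈ w i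
      unscale w = trans (sym (*-assoc _ _ _)) (trans (*-congʳ (τ-inverse i)) (*-identityˡ _))

    e : Vector Carrier r
    e p = if does (isDiagonal? p) then 1# else 0#

    -- On the diagonal the valency is 1, so the scaling disappears; a block that contains (x , y)
    -- with x ≠ y is not diagonal, so `e` vanishes there.
    Φ-e : ∀ x y → Φ e x y ≈ 𝟙 x y
    Φ-e x y with x Fin.≟ y
    ... | yes ≡.refl = begin
      τ p * ⟦ isDiagonal? p ⟧ ≈⟨ *-cong (τ-diagonal p p-diagonal) (⟦⟧-true (isDiagonal? p) p-diagonal) ⟩
      1# * 1#                 ≈⟨ *-identityˡ 1# ⟩
      1#                      ∎
      where
      p = block x x
      p-diagonal = diagonal p x ≡.refl
    ... | no x≢y = trans
      (*-congˡ (⟦⟧-false (isDiagonal? (block x y)) λ h → x≢y (h x y ≡.refl))) (zeroʳ _)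

    infix 9 _†
    _† : Op₁ (Vector Carrier r)
    (u †) i = u (conv i) ⋆

    †-involutive : ∀ u i → ((u †) †) i ≈ u i
    †-involutive u i = trans (⋆-involutive _) (reflexive (cong u (conv-involutive i)))

    -- Transposition moves an entry to the converse block, which is scaled by its own valency.
    -- Equality of the valencies of a block and its converse, in the form `τ-conv`, reconciles the
    -- two factors.
    Φ-† : ∀ u x y → Φ (u †) x y ≈ (Φ u ᴴ) x y
    Φ-† u x y = begin
      τ (block x y) * u (conv (block x y)) ⋆
        ≈⟨ *-congʳ (τ-conv (block x y)) ⟨
      τ (conv (block x y)) * u (conv (block x y)) ⋆
        ≡⟨ cong (λ i → τ i * u i ⋆) (conv-block x y) ⟩
      τ (block y x) * u (block y x) ⋆
        ≈⟨ *-congʳ (1/√-real _ {{∥∥-nonZero (block y x)}}) ⟨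
      τ (block y x) ⋆ * u (block y x) ⋆
        ≈⟨ ⋆-* _ _ ⟨
      (τ (block y x) * u (block y x)) ⋆ ∎

    -- Replacing ∇ by a sum of indicators over the middle point z makes i and j free. For each z
    -- exactly one pair (i , j) survives, the blocks of the two steps x → z and z → y.
    convolution : ∀ (p q : Vector Carrier r) x y →
      ∑[ i < r ] ∑[ j < r ] ((p i * q j) * (∇ i j (block x y) ⋅ 1#)) ≈
      ∑[ z < n ] (p (block x z) * q (block z y))
    convolution p q x y = begin
      ∑[ i < r ] ∑[ j < r ] ((p i * q j) * (∇ i j (block x y) ⋅ 1#))
        ≈⟨ ∑-cong r (λ i → ∑-cong r λ j → split i j) ⟩
      ∑[ i < r ] ∑[ j < r ] ∑[ z < n ] P i j z
        ≈⟨ ∑-cong r (λ i → ∑-comm (P i)) ⟩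
      ∑[ i < r ] ∑[ z < n ] ∑[ j < r ] P i j z
        ≈⟨ ∑-comm (λ i z → ∑[ j < r ] P i j z) ⟩
      ∑[ z < n ] ∑[ i < r ] ∑[ j < r ] P i j z
        ≈⟨ ∑-cong n (λ z → ∑-cong r λ i → trans (sym (∑-distribˡ-* r _)) (*-congˡ (sum-δ (block z y) q))) ⟩
      ∑[ z < n ] ∑[ i < r ] ((⟦ block x z Fin.≟ i ⟧ * p i) * q (block z y))
        ≈⟨ ∑-cong n (λ z → trans (sym (∑-distribʳ-* r _)) (*-congʳ (sum-δ (block x z) p))) ⟩
      ∑[ z < n ] (p (block x z) * q (block z y)) ∎
      where
      P : Fin r → Fin r → Fin n → Carrier
      P i j z = (⟦ block x z Fin.≟ i ⟧ * p i) * (⟦ block z y Fin.≟ j ⟧ * q j)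
      edge? : ∀ i j → Decidable (λ z → block x z ≡ i × block z y ≡ j)
      edge? i j z = (block x z Fin.≟ i) ×-dec (block z y Fin.≟ j)
      split : ∀ i j → (p i * q j) * (∇ i j (block x y) ⋅ 1#) ≈ ∑[ z < n ] P i j z
      split i j = begin
        (p i * q j) * (∇ i j (block x y) ⋅ 1#)
          ≡⟨ cong (λ m → (p i * q j) * (m ⋅ 1#)) (proj₂ (coherent i j (block x y)) x y ≡.refl) ⟨
        (p i * q j) * (paths i j x y ⋅ 1#)
          ≈⟨ *-congˡ (count-sum (edge? i j) id) ⟩
        (p i * q j) * ∑[ z < n ] ⟦ edge? i j z ⟧
          ≈⟨ ∑-distribˡ-* n _ ⟩
        ∑[ z < n ] ((p i * q j) * ⟦ edge? i j z ⟧)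
          ≈⟨ ∑-cong n (λ z → trans (*-congˡ (⟦⟧-× (block x z Fin.≟ i) (block z y Fin.≟ j)))
               (trans (*-comm _ _) (interchange _ _ _ _))) ⟩
        ∑[ z < n ] P i j z ∎

    ⟨_∣_⟩ : Vector Carrier r → Vector Carrier r → Carrier
    ⟨ u ∣ v ⟩ = ∑[ i < r ] (u i ⋆ * v i)

    -- The summand at (x , y) depends on the block of the pair alone. Grouping the pairs by block
    -- weights each coordinate by the number of its pairs.
    ⟪Φ,Φ⟫ : ∀ u v → ⟪ Φ u , Φ v ⟫ ≈ ∑[ i < r ] ((cardinality i ⋅ 1#) * ((τ i * τ i) * (u i ⋆ * v i)))
    ⟪Φ,Φ⟫ u v = begin
      ∑[ x < n ] ∑[ y < n ] (Φ u x y ⋆ * Φ v x y)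
        ≈⟨ ∑-cong n (λ x → ∑-cong n λ y → trans (*-congʳ (⋆-τ* _)) (interchange _ _ _ _)) ⟩
      ∑[ x < n ] ∑[ y < n ] f (block x y)
        ≈⟨ ∑-cong n (λ x → ∑-cong n λ y → sum-δ (block x y) f) ⟨
      ∑[ x < n ] ∑[ y < n ] ∑[ i < r ] (⟦ block x y Fin.≟ i ⟧ * f i)
        ≈⟨ ∑-cong n (λ x → ∑-comm (λ y i → ⟦ block x y Fin.≟ i ⟧ * f i)) ⟩
      ∑[ x < n ] ∑[ i < r ] ∑[ y < n ] (⟦ block x y Fin.≟ i ⟧ * f i)
        ≈⟨ ∑-comm (λ x i → ∑[ y < n ] (⟦ block x y Fin.≟ i ⟧ * f i)) ⟩
      ∑[ i < r ] ∑[ x < n ] ∑[ y < n ] (⟦ block x y Fin.≟ i ⟧ * f i)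
        ≈⟨ ∑-cong r (λ i → trans (∑-distribʳ-* n (f i)) (∑-cong n λ x → ∑-distribʳ-* n (f i))) ⟨
      ∑[ i < r ] (∑[ x < n ] ∑[ y < n ] ⟦ block x y Fin.≟ i ⟧ * f i)
        ≈⟨ ∑-cong r (λ i → *-congʳ (count-allPairs (λ xy → block (proj₁ xy) (proj₂ xy) Fin.≟ i) id id)) ⟨
      ∑[ i < r ] ((cardinality i ⋅ 1#) * f i) ∎
      where
      f : Fin r → Carrier
      f i = (τ i * τ i) * (u i ⋆ * v i)
      ⋆-τ* : ∀ i → (τ i * u i) ⋆ ≈ τ i * u i ⋆
      ⋆-τ* i = trans (⋆-* _ _) (*-congʳ (1/√-real _ {{∥∥-nonZero i}}))

    ⟨⟩≈⟪Φ,Φ⟫ : ∃[ k ] ∀ u v → ⟨ u ∣ v ⟩ ≈ k * ⟪ Φ u , Φ v ⟫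
    ⟨⟩≈⟪Φ,Φ⟫ with ∃-fibreSize ½-homogeneous
    ... | N , N≢0 , cardinality≡N*∥∥ = k , λ u v → begin
      ∑[ i < r ] (u i ⋆ * v i)
        ≈⟨ ∑-cong r (λ i → sym (weight i (u i ⋆ * v i))) ⟩
      ∑[ i < r ] (k * ((cardinality i ⋅ 1#) * ((τ i * τ i) * (u i ⋆ * v i))))
        ≈⟨ ∑-distribˡ-* r k ⟨
      k * ∑[ i < r ] ((cardinality i ⋅ 1#) * ((τ i * τ i) * (u i ⋆ * v i)))
        ≈⟨ *-congˡ (⟪Φ,Φ⟫ u v) ⟨
      k * ⟪ Φ u , Φ v ⟫ ∎
      where
      instance _ = N≢0
      -- This is 1/N. Coordinate i of the trace form has weight `cardinality i` · τ² = N ∥i∥ / ∥i∥ =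
      -- N, which `k` cancels.
      k = 1/√ N * 1/√ N
      weight : ∀ i w → k * ((cardinality i ⋅ 1#) * ((τ i * τ i) * w)) ≈ w
      weight i w = begin
        k * ((cardinality i ⋅ 1#) * ((τ i * τ i) * w))
          ≈⟨ *-congˡ (*-congʳ (trans (reflexive (cong (_⋅ 1#) (cardinality≡N*∥∥ i))) (×1-homo-* N ∥ i ∥))) ⟩
        k * (((N ⋅ 1#) * (∥ i ∥ ⋅ 1#)) * ((τ i * τ i) * w))
          ≈⟨ trans (*-congˡ (*-assoc _ _ _)) (x∙yz≈yx∙z _ _ _) ⟩
        ((N ⋅ 1#) * k) * ((∥ i ∥ ⋅ 1#) * ((τ i * τ i) * w))
          ≈⟨ *-congʳ (1/√-inverse N) ⟩
        1# * ((∥ i ∥ ⋅ 1#) * ((τ i * τ i) * w))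
          ≈⟨ trans (*-identityˡ _) (sym (*-assoc _ _ _)) ⟩
        ((∥ i ∥ ⋅ 1#) * (τ i * τ i)) * w
          ≈⟨ *-congʳ (1/√-inverse ∥ i ∥ {{∥∥-nonZero i}}) ⟩
        1# * w
          ≈⟨ *-identityˡ w ⟩
        w ∎

    -- `M≈` is the splitting √(∥l∥ / (∥i∥ ∥j∥)) = √∥l∥ · 1/√∥i∥ · 1/√∥j∥ with √∥l∥ in the form ∥l∥ ·
    -- `τ l`. Only this property of the constants is used, so their analytic definition stays out of
    -- sight.
    module Product
      (M : Fin r → Fin r → Fin r → Carrier)
      (M≈ : ∀ i j l → M i j l ≈ ((∥ l ∥ ⋅ 1#) * τ l) * (τ i * τ j) * (∇ i j l ⋅ 1#))
      where

      infixl 7 _∙_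
      _∙_ : Op₂ (Vector Carrier r)
      (u ∙ v) l = ∑[ i < r ] ∑[ j < r ] (u i * v j * M i j l)

      -- The scaling `τ l` of the result cancels the √∥l∥ in the structure constant, and the
      -- remaining `τ i` and `τ j` are exactly the scalings of `u` and `v`. What is left is
      -- `convolution`.
      Φ-∙ : ∀ u v x y → Φ (u ∙ v) x y ≈ (Φ u ⊗ Φ v) x y
      Φ-∙ u v x y = begin
        τ l * ∑[ i < r ] ∑[ j < r ] (u i * v j * M i j l)
          ≈⟨ trans (∑-distribˡ-* r (τ l)) (∑-cong r λ i → ∑-distribˡ-* r (τ l)) ⟩
        ∑[ i < r ] ∑[ j < r ] (τ l * (u i * v j * M i j l))
          ≈⟨ ∑-cong r (λ i → ∑-cong r λ j → rescale i j) ⟩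
        ∑[ i < r ] ∑[ j < r ] (((τ i * u i) * (τ j * v j)) * (∇ i j l ⋅ 1#))
          ≈⟨ convolution (λ i → τ i * u i) (λ j → τ j * v j) x y ⟩
        (Φ u ⊗ Φ v) x y ∎
        where
        l = block x y
        rescale : ∀ i j → τ l * (u i * v j * M i j l) ≈ ((τ i * u i) * (τ j * v j)) * (∇ i j l ⋅ 1#)
        rescale i j = begin
          τ l * (u i * v j * M i j l)
            ≈⟨ *-congˡ (*-congˡ (trans (M≈ i j l) (*-assoc _ _ _))) ⟩
          τ l * ((u i * v j) * (s * ((τ i * τ j) * m)))
            ≈⟨ *-congˡ (x∙yz≈y∙xz _ _ _) ⟩
          τ l * (s * ((u i * v j) * ((τ i * τ j) * m)))
            ≈⟨ x∙yz≈yx∙z _ _ _ ⟩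
          (s * τ l) * ((u i * v j) * ((τ i * τ j) * m))
            ≈⟨ *-congʳ (τ-inverse l) ⟩
          1# * ((u i * v j) * ((τ i * τ j) * m))
            ≈⟨ trans (*-identityˡ _) (x∙yz≈yx∙z _ _ _) ⟩
          ((τ i * τ j) * (u i * v j)) * m
            ≈⟨ *-congʳ (interchange _ _ _ _) ⟩
          ((τ i * u i) * (τ j * v j)) * m ∎
          where
          s = (∥ l ∥ ⋅ 1#) * τ l
          m = ∇ i j l ⋅ 1#

      ∙-assoc : ∀ u v w i → ((u ∙ v) ∙ w) i ≈ (u ∙ (v ∙ w)) i
      ∙-assoc u v w = Φ-injective _ _ λ x y → begin
        Φ ((u ∙ v) ∙ w) x y         ≈⟨ Φ-∙ (u ∙ v) w x y ⟩
        (Φ (u ∙ v) ⊗ Φ w) x y       ≈⟨ ⊗-congʳ (Φ w) (Φ-∙ u v) x y ⟩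
        ((Φ u ⊗ Φ v) ⊗ Φ w) x y     ≈⟨ ⊗-assoc (Φ u) (Φ v) (Φ w) x y ⟩
        (Φ u ⊗ (Φ v ⊗ Φ w)) x y     ≈⟨ ⊗-congˡ (Φ u) (Φ-∙ v w) x y ⟨
        (Φ u ⊗ Φ (v ∙ w)) x y       ≈⟨ Φ-∙ u (v ∙ w) x y ⟨
        Φ (u ∙ (v ∙ w)) x y         ∎

      ∙-identityˡ : ∀ u i → (e ∙ u) i ≈ u i
      ∙-identityˡ u = Φ-injective _ _ λ x y →
        trans (Φ-∙ e u x y) (trans (⊗-congʳ (Φ u) Φ-e x y) (⊗-identityˡ (Φ u) x y))

      ∙-identityʳ : ∀ u i → (u ∙ e) i ≈ u i
      ∙-identityʳ u = Φ-injective _ _ λ x y →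
        trans (Φ-∙ u e x y) (trans (⊗-congˡ (Φ u) Φ-e x y) (⊗-identityʳ (Φ u) x y))

      adjointˡ : ∀ u v w → ⟨ u ∙ v ∣ w ⟩ ≈ ⟨ v ∣ u † ∙ w ⟩
      adjointˡ u v w with ⟨⟩≈⟪Φ,Φ⟫
      ... | k , ⟨⟩≈k⟪⟫ = begin
        ⟨ u ∙ v ∣ w ⟩                  ≈⟨ ⟨⟩≈k⟪⟫ (u ∙ v) w ⟩
        k * ⟪ Φ (u ∙ v) , Φ w ⟫        ≈⟨ *-congˡ (⟪⟫-congʳ (Φ w) (Φ-∙ u v)) ⟩
        k * ⟪ Φ u ⊗ Φ v , Φ w ⟫        ≈⟨ *-congˡ (⟪⟫-adjointˡ (Φ u) (Φ v) (Φ w)) ⟩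
        k * ⟪ Φ v , Φ u ᴴ ⊗ Φ w ⟫      ≈⟨ *-congˡ (⟪⟫-congˡ (Φ v) (⊗-congʳ (Φ w) (Φ-† u))) ⟨
        k * ⟪ Φ v , Φ (u †) ⊗ Φ w ⟫    ≈⟨ *-congˡ (⟪⟫-congˡ (Φ v) (Φ-∙ (u †) w)) ⟨
        k * ⟪ Φ v , Φ (u † ∙ w) ⟫      ≈⟨ ⟨⟩≈k⟪⟫ v (u † ∙ w) ⟨
        ⟨ v ∣ u † ∙ w ⟩                ∎

      adjointʳ : ∀ u v w → ⟨ u ∙ v ∣ w ⟩ ≈ ⟨ u ∣ w ∙ v † ⟩
      adjointʳ u v w with ⟨⟩≈⟪Φ,Φ⟫
      ... | k , ⟨⟩≈k⟪⟫ = begin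
        ⟨ u ∙ v ∣ w ⟩                  ≈⟨ ⟨⟩≈k⟪⟫ (u ∙ v) w ⟩
        k * ⟪ Φ (u ∙ v) , Φ w ⟫        ≈⟨ *-congˡ (⟪⟫-congʳ (Φ w) (Φ-∙ u v)) ⟩
        k * ⟪ Φ u ⊗ Φ v , Φ w ⟫        ≈⟨ *-congˡ (⟪⟫-adjointʳ (Φ u) (Φ v) (Φ w)) ⟩
        k * ⟪ Φ u , Φ w ⊗ Φ v ᴴ ⟫      ≈⟨ *-congˡ (⟪⟫-congˡ (Φ u) (⊗-congˡ (Φ w) (Φ-† v))) ⟨
        k * ⟪ Φ u , Φ w ⊗ Φ (v †) ⟫    ≈⟨ *-congˡ (⟪⟫-congˡ (Φ u) (Φ-∙ w (v †))) ⟨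
        k * ⟪ Φ u , Φ (w ∙ v †) ⟫      ≈⟨ ⟨⟩≈k⟪⟫ u (w ∙ v †) ⟨
        ⟨ u ∣ w ∙ v † ⟩                ∎

-- Square roots

open import Defs hiding (_+_; _*_; -_; _≈_)
open ≡ using (refl; subst; subst₂)

module _ where
  open import Data.Rational.Base using (_+_; _*_; _-_; -_; _/_; ∣_∣; _<_; _≤_)
  open ℚ-Solver using (solve; _:+_; _:*_; _:-_; _:=_; :-_; con)

  p≤∣p∣ : ∀ p → p ≤ ∣ p ∣
  p≤∣p∣ p with ℚ.≤-total 0ℚ p
  ... | inj₁ 0≤p = ℚ.≤-reflexive (≡.sym (ℚ.0≤p⇒∣p∣≡p 0≤p))
  ... | inj₂ p≤0 = ℚ.≤-trans p≤0 (ℚ.0≤∣p∣ p)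

  ∣-∣-<⇒< : ∀ p q {ε} → ∣ p - q ∣ < ε → p < q + ε
  ∣-∣-<⇒< p q {ε} h = subst (_< q + ε)
    (solve 2 (λ a b → b :+ (a :- b) := a) refl p q)
    (ℚ.+-monoʳ-< q (ℚ.≤-<-trans (p≤∣p∣ (p - q)) h))

  p≤p+q : ∀ p {q} → 0ℚ ≤ q → p ≤ p + q
  p≤p+q p {q} 0≤q = subst (_≤ p + q) (ℚ.+-identityʳ p) (ℚ.+-monoʳ-≤ p 0≤q)

  q≤p+q : ∀ {p} q → 0ℚ ≤ p → q ≤ p + q
  q≤p+q {p} q 0≤p = subst (q ≤_) (ℚ.+-comm q p) (p≤p+q q 0≤p)

  p<p+q : ∀ p {q} → 0ℚ < q → p < p + q
  p<p+q p {q} 0<q = subst (_< p + q) (ℚ.+-identityʳ p) (ℚ.+-monoʳ-< p 0<q)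

  +-nonNeg : ∀ {p q} → 0ℚ ≤ p → 0ℚ ≤ q → 0ℚ ≤ p + q
  +-nonNeg 0≤p 0≤q = ℚ.+-mono-≤ 0≤p 0≤q

  *-nonNeg : ∀ {p q} → 0ℚ ≤ p → 0ℚ ≤ q → 0ℚ ≤ p * q
  *-nonNeg {p} {q} 0≤p 0≤q = ℚ.nonNegative⁻¹ _
    {{ℚ.nonNeg*nonNeg⇒nonNeg p {{ℚ.nonNegative 0≤p}} q {{ℚ.nonNegative 0≤q}}}}

  *-pos : ∀ {p q} → 0ℚ < p → 0ℚ < q → 0ℚ < p * q
  *-pos {p} {q} 0<p 0<q = ℚ.positive⁻¹ _
    {{ℚ.pos*pos⇒pos p {{ℚ.positive 0<p}} q {{ℚ.positive 0<q}}}}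

  ∣p∣²≡p² : ∀ p → ∣ p ∣ * ∣ p ∣ ≡ p * p
  ∣p∣²≡p² p with ℚ.∣p∣≡p∨∣p∣≡-p p
  ... | inj₁ eq rewrite eq = refl
  ... | inj₂ eq rewrite eq = solve 1 (λ a → :- a :* :- a := a :* a) refl p

  p²-nonNeg : ∀ p → 0ℚ ≤ p * p
  p²-nonNeg p = subst (0ℚ ≤_) (∣p∣²≡p² p) (*-nonNeg (ℚ.0≤∣p∣ p) (ℚ.0≤∣p∣ p))

  p²<q²⇒p<q : ∀ {p q} → 0ℚ ≤ q → p * p < q * q → p < q
  p²<q²⇒p<q {p} {q} 0≤q h = ℚ.≰⇒> λ q≤p → ℚ.<-irrefl refl (ℚ.<-≤-trans h (ℚ.≤-trans
    (ℚ.*-monoʳ-≤-nonNeg q {{ℚ.nonNegative 0≤q}} q≤p)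
    (ℚ.*-monoˡ-≤-nonNeg p {{ℚ.nonNegative (ℚ.≤-trans 0≤q q≤p)}} q≤p)))

  p²<ε²⇒∣p∣<ε : ∀ p {ε} → 0ℚ < ε → p * p < ε * ε → ∣ p ∣ < ε
  p²<ε²⇒∣p∣<ε p 0<ε h = p²<q²⇒p<q (ℚ.<⇒≤ 0<ε) (subst (_< _) (≡.sym (∣p∣²≡p² p)) h)

  -- The root is uniformly continuous on non-negative numbers: a² < b² + ε² ≤ (b + ε)² gives a < b +
  -- ε, and the situation is symmetric.
  ∣p²-q²∣<ε²⇒∣p-q∣<ε : ∀ {p q ε} → 0ℚ ≤ p → 0ℚ ≤ q → 0ℚ < ε →
                       ∣ p * p - q * q ∣ < ε * ε → ∣ p - q ∣ < ε
  ∣p²-q²∣<ε²⇒∣p-q∣<ε {p} {q} {ε} 0≤p 0≤q 0<ε h =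
    ∣-∣-< p q (bound 0≤q h) (bound 0≤p (subst (_< ε * ε) (∣-∣-swap (p * p) (q * q)) h))
    where
    bound : ∀ {a b} → 0ℚ ≤ b → ∣ a * a - b * b ∣ < ε * ε → a < b + ε
    bound {a} {b} 0≤b k = p²<q²⇒p<q (+-nonNeg 0≤b (ℚ.<⇒≤ 0<ε)) (ℚ.<-≤-trans
      (∣-∣-<⇒< (a * a) (b * b) k)
      (subst (b * b + ε * ε ≤_)
        (solve 2 (λ b e → (b :* b :+ e :* e) :+ (b :* e :+ b :* e) := (b :+ e) :* (b :+ e)) refl b ε)
        (p≤p+q _ (+-nonNeg (*-nonNeg 0≤b (ℚ.<⇒≤ 0<ε)) (*-nonNeg 0≤b (ℚ.<⇒≤ 0<ε))))))

  +/-mono-≤ : ∀ m n d e .{{_ : NonZero d}} .{{_ : NonZero e}} →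
              m ℕ.* e ℕ.≤ n ℕ.* d → (+ m) / d ≤ (+ n) / e
  +/-mono-≤ m n (suc d) (suc e) h = ℚ.toℚᵘ-cancel-≤ (ℚᵘ.≤-respˡ-≃
    (ℚᵘ.≃-sym (ℚ.toℚᵘ-fromℚᵘ (mkℚᵘ (+ m) d)))
    (ℚᵘ.≤-respʳ-≃ (ℚᵘ.≃-sym (ℚ.toℚᵘ-fromℚᵘ (mkℚᵘ (+ n) e)))
      (ℚᵘ.*≤* (subst₂ ℤ._≤_ (ℤ.pos-* m (suc e)) (ℤ.pos-* n (suc d)) (ℤ.+≤+ h)))))

  +/-* : ∀ m n d e .{{_ : NonZero d}} .{{_ : NonZero e}} →
         (+ m) / d * ((+ n) / e) ≡ ((+ (m ℕ.* n)) / (d ℕ.* e)) {{ℕ.m*n≢0 d e}}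
  +/-* m n (suc d) (suc e) = ℚ.toℚᵘ-injective (ℚᵘ.≃-trans
    (ℚ.toℚᵘ-homo-* ((+ m) / suc d) ((+ n) / suc e))
    (ℚᵘ.≃-trans
      (ℚᵘ.*-cong (ℚ.toℚᵘ-fromℚᵘ (mkℚᵘ (+ m) d)) (ℚ.toℚᵘ-fromℚᵘ (mkℚᵘ (+ n) e)))
      (ℚᵘ.≃-trans (ℚᵘ.≃-reflexive (cong (λ z → mkℚᵘ z (e ℕ.+ d ℕ.* suc e)) (≡.sym (ℤ.pos-* m n))))
        (ℚᵘ.≃-sym (ℚ.toℚᵘ-fromℚᵘ (mkℚᵘ (+ (m ℕ.* n)) (e ℕ.+ d ℕ.* suc e)))))))

  +/-nonNeg : ∀ m d .{{_ : NonZero d}} → 0ℚ ≤ (+ m) / d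
  +/-nonNeg m d = +/-mono-≤ 0 m 1 d ℕ.z≤n

module _ where
  open Sqrt
  open import Data.Rational.Base using (_+_; _*_; _/_; _≤_; _<_)

  private
    integer-* : ∀ d m k .{{_ : NonZero k}} →
      (+ d) / 1 * ((+ m) / k * ((+ m) / k)) ≡
      ((+ (d ℕ.* (m ℕ.* m))) / (1 ℕ.* (k ℕ.* k))) {{ℕ.m*n≢0 1 (k ℕ.* k) {{_}} {{ℕ.m*n≢0 k k}}}}
    integer-* d m k = ≡.trans (cong ((+ d) / 1 *_) (+/-* m m k k))
      (+/-* d (m ℕ.* m) 1 (k ℕ.* k) {{_}} {{ℕ.m*n≢0 k k}})

  approx-nonNeg : ∀ p d .{{_ : NonZero d}} n → 0ℚ ≤ approx p d n
  approx-nonNeg p d n =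
    +/-nonNeg (isqrt ((p ℕ.* d) ℕ.* (suc n ℕ.* suc n))) (d ℕ.* suc n) {{ℕ.m*n≢0 d (suc n)}}

  -- With a = approx p d n and g = gap d n these bounds are (d a)² ≤ p d ≤ (d (a + g))²,
  -- divided by d.
  approx-lower : ∀ p d .{{_ : NonZero d}} n → (+ d) / 1 * (approx p d n * approx p d n) ≤ (+ p) / 1
  approx-lower p d n = subst (_≤ (+ p) / 1) (≡.sym (integer-* d A K))
    (+/-mono-≤ (d ℕ.* (A ℕ.* A)) p (1 ℕ.* (K ℕ.* K)) 1 (begin
      (d ℕ.* (A ℕ.* A)) ℕ.* 1                          ≡⟨ ℕ.*-identityʳ _ ⟩
      d ℕ.* (A ℕ.* A)                                  ≤⟨ ℕ.*-monoʳ-≤ d (isqrt-lower ((p ℕ.* d) ℕ.* (k ℕ.* k))) ⟩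
      d ℕ.* ((p ℕ.* d) ℕ.* (k ℕ.* k))
        ≡⟨ solve 3 (λ p d k → d :* ((p :* d) :* (k :* k))
             := p :* (con 1 :* ((d :* k) :* (d :* k)))) refl p d k ⟩
      p ℕ.* (1 ℕ.* (K ℕ.* K))                          ∎))
    where
    k = suc n
    K = d ℕ.* k
    A = isqrt ((p ℕ.* d) ℕ.* (k ℕ.* k))
    instance
      K≢0 = ℕ.m*n≢0 d k
      KK≢0 = ℕ.m*n≢0 1 (K ℕ.* K) {{_}} {{ℕ.m*n≢0 K K}}
    open ℕ.≤-Reasoning
    open ℕ-Solver using (solve; _:*_; _:=_; con)

  gap : ∀ d .{{_ : NonZero d}} → ℕ → ℚ
  gap d n = ((+ 1) / (d ℕ.* suc n)) {{ℕ.m*n≢0 d (suc n)}}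

  approx-upper : ∀ p d .{{_ : NonZero d}} n → let a = approx p d n + gap d n in
                 (+ p) / 1 ≤ (+ d) / 1 * (a * a)
  approx-upper p d n = subst ((+ p) / 1 ≤_)
    (≡.sym (≡.trans (cong (λ a → (+ d) / 1 * (a * a)) (+/-+ A 1 K)) (integer-* d (A ℕ.+ 1) K)))
    (+/-mono-≤ p (d ℕ.* ((A ℕ.+ 1) ℕ.* (A ℕ.+ 1))) 1 (1 ℕ.* (K ℕ.* K)) (begin
      p ℕ.* (1 ℕ.* (K ℕ.* K))
        ≡⟨ solve 3 (λ p d k → d :* ((p :* d) :* (k :* k))
             := p :* (con 1 :* ((d :* k) :* (d :* k)))) refl p d k ⟨
      d ℕ.* ((p ℕ.* d) ℕ.* (k ℕ.* k))            ≤⟨ ℕ.*-monoʳ-≤ d (ℕ.<⇒≤ (isqrt-upper ((p ℕ.* d) ℕ.* (k ℕ.* k)))) ⟩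
      d ℕ.* (suc A ℕ.* suc A)                    ≡⟨ cong (λ B → d ℕ.* (B ℕ.* B)) (ℕ.+-comm 1 A) ⟩
      d ℕ.* ((A ℕ.+ 1) ℕ.* (A ℕ.+ 1))            ≡⟨ ℕ.*-identityʳ _ ⟨
      (d ℕ.* ((A ℕ.+ 1) ℕ.* (A ℕ.+ 1))) ℕ.* 1    ∎))
    where
    k = suc n
    K = d ℕ.* k
    A = isqrt ((p ℕ.* d) ℕ.* (k ℕ.* k))
    instance
      K≢0 = ℕ.m*n≢0 d k
      KK≢0 = ℕ.m*n≢0 1 (K ℕ.* K) {{_}} {{ℕ.m*n≢0 K K}}
    open ℕ.≤-Reasoning
    open ℕ-Solver using (solve; _:*_; _:=_; con)

  gap-small : ∀ d .{{_ : NonZero d}} {ε} → 0ℚ < ε → ∀ n → ℚ.↧ₙ ε ℕ.≤ n → ℚ.∣ gap d n ∣ < ε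
  gap-small d 0<ε n le = subst (_< _) (≡.sym (ℚ.0≤p⇒∣p∣≡p (+/-nonNeg 1 (d ℕ.* suc n) {{ℕ.m*n≢0 d (suc n)}})))
    (1/<ε 0<ε (d ℕ.* suc n) {{ℕ.m*n≢0 d (suc n)}} (ℕ.≤-trans (ℕ.s≤s le) (ℕ.m≤n*m (suc n) d)))

  -- With the error as a real number, the upper bounds are the terms of d (√ + gap)², and congruence
  -- of the real operations replaces an explicit estimate of their convergence.
  gapᴿ : ∀ d .{{_ : NonZero d}} → ℝ
  gapᴿ d = mkℝ (gap d) λ ε 0<ε → ℚ.↧ₙ (½ * ε) , λ m n le le′ →
    subst (_ <_) (½-split ε)
      (ℚ.≤-<-trans (ℚ.∣p-q∣≤∣p∣+∣q∣ (gap d m) (gap d n))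
        (ℚ.+-mono-< (gap-small d (½-pos 0<ε) m le) (gap-small d (½-pos 0<ε) n le′)))

squeeze : ∀ {x y z} → (∀ n → seq x n ℚ.≤ seq z n) → (∀ n → seq z n ℚ.≤ seq y n) → x ≈ᴿ y → x ≈ᴿ z
squeeze {x} {y} {z} x≤z z≤y x≈y = mk≈ λ ε 0<ε → let (N , h) = close x≈y ε 0<ε in
  N , λ n le → ∣-∣-< (seq x n) (seq z n)
    (ℚ.≤-<-trans (x≤z n) (p<p+q (seq z n) 0<ε))
    (ℚ.≤-<-trans (z≤y n)
      (∣-∣-<⇒< (seq y n) (seq x n) (subst (ℚ._< ε) (∣-∣-swap (seq x n) (seq y n)) (h n le))))

private module R = CommutativeRing ℝ-commutativeRing

-- Term by term the constant p lies between d a² and d (a + g)². These bounds represent the same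
-- real because the gap tends to 0, so p is squeezed between them.
√-square : ∀ p d .{{_ : NonZero d}} → fromℕ d *ᴿ (√[ p / d ] *ᴿ √[ p / d ]) ≈ᴿ fromℕ p
√-square p d = squeeze (approx-lower p d) (approx-upper p d) (R.*-congˡ {fromℕ d} (R.*-cong √≈ √≈))
  where
  √≈ : √[ p / d ] ≈ᴿ √[ p / d ] +ᴿ gapᴿ d
  √≈ = R.trans (R.sym (R.+-identityʳ _)) (R.+-congˡ {√[ p / d ]} (R.sym gap≈0))
    where
    gap≈0 : gapᴿ d ≈ᴿ 0ᴿ
    gap≈0 = mk≈ λ ε 0<ε → ℚ.↧ₙ ε , λ n le →
      subst (λ q → ℚ.∣ q ∣ ℚ.< ε) (≡.sym (ℚ.+-identityʳ (gap d n))) (gap-small d 0<ε n le)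

-- Non-negativity of every term, which is stronger than `0ᴿ ≤ᴿ x`. It passes to products without
-- estimates, and the approximations of `√[_/_]` have it.
NonNegative : ℝ → Set
NonNegative x = ∀ n → 0ℚ ℚ.≤ seq x n

√-nonNegative : ∀ p d .{{_ : NonZero d}} → NonNegative √[ p / d ]
√-nonNegative = approx-nonNeg

*ᴿ-nonNegative : ∀ {x y} → NonNegative x → NonNegative y → NonNegative (x *ᴿ y)
*ᴿ-nonNegative 0≤x 0≤y n = *-nonNeg (0≤x n) (0≤y n)

square-injective : ∀ {x y} → NonNegative x → NonNegative y → x *ᴿ x ≈ᴿ y *ᴿ y → x ≈ᴿ y
square-injective {x} {y} 0≤x 0≤y x²≈y² = mk≈ λ ε 0<ε →
  let (N , h) = close x²≈y² (ε ℚ.* ε) (*-pos 0<ε 0<ε)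
  in N , λ n le → ∣p²-q²∣<ε²⇒∣p-q∣<ε (0≤x n) (0≤y n) 0<ε (h n le)

-- Completeness of ℂ^ k

-- Convergence of a sequence of reals to 0. Since a real is known only through its terms, ∣x n∣ < ε
-- is read as a bound on all late terms of `x n`, where "late" may depend on n.
Null : (ℕ → ℝ) → Set
Null x = ∀ ε → 0ℚ ℚ.< ε → ∃[ N ] ∀ n → N ℕ.≤ n → ∃[ T ] ∀ t → T ℕ.≤ t → ℚ.∣ seq (x n) t ∣ ℚ.< ε

Null-+ : ∀ x y → Null x → Null y → Null (λ n → x n +ᴿ y n)
Null-+ x y x→0 y→0 ε 0<ε =
  let (M , h) = x→0 (½ ℚ.* ε) (½-pos 0<ε)
      (N , k) = y→0 (½ ℚ.* ε) (½-pos 0<ε)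
  in M ℕ.⊔ N , λ n n≥ →
    let (S , h′) = h n (ℕ.m⊔n≤o⇒m≤o M N n≥)
        (T , k′) = k n (ℕ.m⊔n≤o⇒n≤o M N n≥)
    in S ℕ.⊔ T , λ t t≥ → subst (_ ℚ.<_) (½-split ε)
         (ℚ.≤-<-trans (ℚ.∣p+q∣≤∣p∣+∣q∣ (seq (x n) t) (seq (y n) t))
           (ℚ.+-mono-< (h′ t (ℕ.m⊔n≤o⇒m≤o S T t≥)) (k′ t (ℕ.m⊔n≤o⇒n≤o S T t≥))))

Null-* : ∀ x y → Null x → Null y → Null (λ n → x n *ᴿ y n)
Null-* x y x→0 y→0 ε 0<ε =
  -- It is enough to bound the first factor by 1, as the second is already below ε.
  let (M , h) = x→0 1ℚ (ℚ.positive⁻¹ 1ℚ)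
      (N , k) = y→0 ε 0<ε
  in M ℕ.⊔ N , λ n n≥ →
    let (S , h′) = h n (ℕ.m⊔n≤o⇒m≤o M N n≥)
        (T , k′) = k n (ℕ.m⊔n≤o⇒n≤o M N n≥)
    in S ℕ.⊔ T , λ t t≥ → subst (_ ℚ.<_) (ℚ.*-identityˡ ε)
         (*-bound (seq (x n) t) (seq (y n) t) (h′ t (ℕ.m⊔n≤o⇒m≤o S T t≥)) (k′ t (ℕ.m⊔n≤o⇒n≤o S T t≥)))

Null-resp : ∀ {x y} → (∀ n t → seq (x n) t ≡ seq (y n) t) → Null x → Null y
Null-resp x≗y x→0 ε 0<ε = let (N , h) = x→0 ε 0<ε in
  N , λ n n≥ → let (T , k) = h n n≥ in T , λ t t≥ → subst (λ q → ℚ.∣ q ∣ ℚ.< ε) (x≗y n t) (k t t≥)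

IsCauchyᴿ : (ℕ → ℝ) → Set
IsCauchyᴿ x = ∀ ε → 0ℚ ℚ.< ε → ∃[ N ] ∀ m n → N ℕ.≤ m → N ℕ.≤ n →
              ∃[ T ] ∀ t → T ℕ.≤ t → ℚ.∣ seq (x m) t ℚ.- seq (x n) t ∣ ℚ.< ε

-- The limit is the diagonal sequence that reads x n off at an index beyond which
-- x n varies by less than 1 / (1 + n).
module Limit (x : ℕ → ℝ) (x-cauchy : IsCauchyᴿ x) where
  open import Data.Rational.Base using (_+_; _-_; _*_; ∣_∣; _<_; _≤_)

  h : ℕ → ℚ
  h n = (+ 1) ℚ./ suc n

  settled : ∀ n → ∃[ T ] ∀ s t → T ℕ.≤ s → T ℕ.≤ t → ∣ seq (x n) s - seq (x n) t ∣ < h n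
  settled n = cauchy (x n) (h n) (+/-mono-< 0 1 1 (suc n) (ℕ.s≤s ℕ.z≤n))

  M : ℕ → ℕ
  M n = proj₁ (settled n)

  diagonal : ℕ → ℚ
  diagonal n = seq (x n) (M n)

  -- The detour goes through a common late index s: from `x m` at u to `x m` at s, on to `x n` at s,
  -- then to `x n` at `M n`, at a cost of ε/4 + ε/2 + ε/4. The case u = `M m` shows that the
  -- diagonal is Cauchy; taking u and the diagonal index both equal to t shows that it is the limit.
  near : ∀ {ε} → 0ℚ < ε → ∃[ N ] ∀ m n u → N ℕ.≤ m → N ℕ.≤ n → M m ℕ.≤ u →
         ∣ seq (x m) u - diagonal n ∣ < ε
  near {ε} 0<ε = N , λ m n u m≥ n≥ u≥ →
    let (T , close-at) = x-close m n (ℕ.m⊔n≤o⇒m≤o A B m≥) (ℕ.m⊔n≤o⇒m≤o A B n≥)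
        s  = M m ℕ.⊔ (M n ℕ.⊔ T)
        s₁ = ℕ.m≤m⊔n (M m) (M n ℕ.⊔ T)
        s₂ = ℕ.≤-trans (ℕ.m≤m⊔n (M n) T) (ℕ.m≤n⊔m (M m) (M n ℕ.⊔ T))
        s₃ = ℕ.≤-trans (ℕ.m≤n⊔m (M n) T) (ℕ.m≤n⊔m (M m) (M n ℕ.⊔ T))
    in subst (_ <_) total
         (ℚ.≤-<-trans (∣-∣-triangle (seq (x m) u) (seq (x m) s) (diagonal n))
           (ℚ.+-mono-< (ℚ.<-trans (proj₂ (settled m) u s u≥ s₁) (h<b m (ℕ.m⊔n≤o⇒n≤o A B m≥)))
             (ℚ.≤-<-trans (∣-∣-triangle (seq (x m) s) (seq (x n) s) (diagonal n))
               (ℚ.+-mono-< (close-at s s₃)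
                 (ℚ.<-trans (proj₂ (settled n) s (M n) s₂ ℕ.≤-refl) (h<b n (ℕ.m⊔n≤o⇒n≤o A B n≥)))))))
    where
    a = ½ * ε
    b = ½ * a
    0<b : 0ℚ < b
    0<b = ½-pos (½-pos 0<ε)
    A = proj₁ (x-cauchy a (½-pos 0<ε))
    x-close = proj₂ (x-cauchy a (½-pos 0<ε))
    B = ℚ.↧ₙ b
    N = A ℕ.⊔ B
    h<b : ∀ n → B ℕ.≤ n → h n < b
    h<b n le = 1/<ε 0<b (suc n) (ℕ.s≤s le)
    open ℚ-Solver using (solve; _:+_; _:=_)
    total : b + (a + b) ≡ ε
    total = ≡.trans (solve 2 (λ a b → b :+ (a :+ b) := a :+ (b :+ b)) refl a b)
      (≡.trans (cong (λ c → a + c) (½-split a)) (½-split ε))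

  limit : ℝ
  limit = mkℝ diagonal λ ε 0<ε → let (N , near-N) = near 0<ε in
    N , λ m n m≥ n≥ → near-N m n (M m) m≥ n≥ ℕ.≤-refl

  converges : Null (λ n → x n +ᴿ -ᴿ limit)
  converges ε 0<ε = let (N , near-N) = near 0<ε in
    N , λ n n≥ → N ℕ.⊔ M n , λ t t≥ →
      near-N n t t n≥ (ℕ.m⊔n≤o⇒m≤o N (M n) t≥) (ℕ.m⊔n≤o⇒n≤o N (M n) t≥)

open import Defs using (_+_; _*_; -_; _≈_)

‖_‖² : ∀ {k} → Vector ℂ k → ℝ
‖ v ‖² = re (standardInnerProduct v v)

module _ where
  open import Data.Rational.Base using (_≤_) renaming (_+_ to _+ℚ_; _*_ to _*ℚ_; -_ to -ℚ_)
  open ℚ-Solver using (solve; _:+_; _:*_; _:=_; :-_)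

  ‖‖²-suc : ∀ {k} (v : Vector ℂ (suc k)) t → let a = seq (re (v zero)) t; b = seq (im (v zero)) t in
            seq ‖ v ‖² t ≡ (a *ℚ a +ℚ b *ℚ b) +ℚ seq ‖ v ∘ suc ‖² t
  ‖‖²-suc v t = cong (_+ℚ seq ‖ v ∘ suc ‖² t)
    (solve 2 (λ a b → a :* a :+ :- (:- b :* b) := a :* a :+ b :* b) refl (seq (re (v zero)) t) (seq (im (v zero)) t))

  ∣_∣² : ℂ → ℕ → ℚ
  ∣ z ∣² t = seq (re z) t *ℚ seq (re z) t +ℚ seq (im z) t *ℚ seq (im z) t

  ∣∣²-nonNeg : ∀ z t → 0ℚ ≤ ∣ z ∣² t
  ∣∣²-nonNeg z t = +-nonNeg (p²-nonNeg (seq (re z) t)) (p²-nonNeg (seq (im z) t))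

  ‖‖²-nonNeg : ∀ {k} (v : Vector ℂ k) → NonNegative ‖ v ‖²
  ‖‖²-nonNeg {zero}  v t = ℚ.≤-refl
  ‖‖²-nonNeg {suc k} v t = subst (0ℚ ≤_) (≡.sym (‖‖²-suc v t))
    (+-nonNeg (∣∣²-nonNeg (v zero) t) (‖‖²-nonNeg (v ∘ suc) t))

  ∣∣²≤‖‖² : ∀ {k} (v : Vector ℂ k) i t → ∣ v i ∣² t ≤ seq ‖ v ‖² t
  ∣∣²≤‖‖² v zero    t = subst (∣ v zero ∣² t ≤_) (≡.sym (‖‖²-suc v t))
    (p≤p+q (∣ v zero ∣² t) (‖‖²-nonNeg (v ∘ suc) t))
  ∣∣²≤‖‖² v (suc i) t = ℚ.≤-trans (∣∣²≤‖‖² (v ∘ suc) i t)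
    (subst (seq ‖ v ∘ suc ‖² t ≤_) (≡.sym (‖‖²-suc v t))
      (q≤p+q (seq ‖ v ∘ suc ‖² t) (∣∣²-nonNeg (v zero) t)))

  re²≤‖‖² : ∀ {k} (v : Vector ℂ k) i t → seq (re (v i)) t *ℚ seq (re (v i)) t ≤ seq ‖ v ‖² t
  re²≤‖‖² v i t = ℚ.≤-trans
    (p≤p+q (seq (re (v i)) t *ℚ seq (re (v i)) t) (p²-nonNeg (seq (im (v i)) t))) (∣∣²≤‖‖² v i t)

  im²≤‖‖² : ∀ {k} (v : Vector ℂ k) i t → seq (im (v i)) t *ℚ seq (im (v i)) t ≤ seq ‖ v ‖² t
  im²≤‖‖² v i t = ℚ.≤-trans
    (q≤p+q (seq (im (v i)) t *ℚ seq (im (v i)) t) (p²-nonNeg (seq (re (v i)) t))) (∣∣²≤‖‖² v i t)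

Null-‖‖² : ∀ {k} (w : ℕ → Vector ℂ k) → (∀ i → Null (λ n → re (w n i))) → (∀ i → Null (λ n → im (w n i))) →
           Null (λ n → ‖ w n ‖²)
Null-‖‖² {zero} w re→0 im→0 ε 0<ε = 0 , λ _ _ → 0 , λ _ _ → 0<ε
Null-‖‖² {suc k} w re→0 im→0 = Null-resp
  {x = λ n → (a n *ᴿ a n +ᴿ b n *ᴿ b n) +ᴿ ‖ w n ∘ suc ‖²} {y = λ n → ‖ w n ‖²}
  (λ n t → ≡.sym (‖‖²-suc (w n) t))
  (Null-+ (λ n → a n *ᴿ a n +ᴿ b n *ᴿ b n) (λ n → ‖ w n ∘ suc ‖²)
    (Null-+ (λ n → a n *ᴿ a n) (λ n → b n *ᴿ b n)
      (Null-* a a (re→0 zero) (re→0 zero))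
      (Null-* b b (im→0 zero) (im→0 zero)))
    (Null-‖‖² (λ n → w n ∘ suc) (re→0 ∘ suc) (im→0 ∘ suc)))
  where
  a b : ℕ → ℝ
  a n = re (w n zero)
  b n = im (w n zero)

-- `≤ᴿ` controls terms only up to a slack; with slack δ² they stay below 2δ² ≤ (2δ)², whence the
-- doubled bound. The index T precedes p, so one T serves the real and imaginary parts of all
-- coordinates at once.
≤ᴿ-square⇒<+ : ∀ {x δ} → 0ℚ ℚ.< δ → x ≤ᴿ ratio (δ ℚ.* δ) →
  ∃[ T ] ∀ t → T ℕ.≤ t → ∀ p → p ℚ.* p ℚ.≤ seq x t → ℚ.∣ p ∣ ℚ.< δ ℚ.+ δ
≤ᴿ-square⇒<+ {x} {δ} 0<δ x≤δ² = let (T , h) = below x≤δ² (δ ℚ.* δ) (*-pos 0<δ 0<δ) in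
  T , λ t t≥ p p²≤x → p²<ε²⇒∣p∣<ε p (ℚ.+-mono-< 0<δ 0<δ)
    (ℚ.≤-<-trans p²≤x (ℚ.<-≤-trans (h t t≥)
      (subst (δ ℚ.* δ ℚ.+ δ ℚ.* δ ℚ.≤_)
        (solve 1 (λ d → (d :* d :+ d :* d) :+ (d :* d :+ d :* d) := (d :+ d) :* (d :+ d)) refl δ)
        (p≤p+q _ (+-nonNeg (p²-nonNeg δ) (p²-nonNeg δ))))))
  where open ℚ-Solver using (solve; _:+_; _:*_; _:=_)

ℂ^-complete : ∀ {k} (v : ℕ → Vector ℂ k) → CauchySequence (ℂ^ k) standardInnerProduct v →
              ∃[ l ] ConvergesTo (ℂ^ k) standardInnerProduct v l
ℂ^-complete {k} v v-cauchy = l , λ ε 0<ε →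
  let (N , h) = Null-‖‖² (λ n i → v n i + - l i) Re.converges Im.converges (ε ℚ.* ε) (*-pos 0<ε 0<ε)
  in N , λ n n≥ → mk≤ λ η 0<η → let (T , h′) = h n n≥ in
    T , λ t t≥ → ℚ.<-trans (ℚ.≤-<-trans (p≤∣p∣ _) (h′ t t≥)) (p<p+q (ε ℚ.* ε) 0<η)
  where
  difference-small : ∀ ε → 0ℚ ℚ.< ε → ∃[ N ] ∀ m n → N ℕ.≤ m → N ℕ.≤ n → ∃[ T ] ∀ t → T ℕ.≤ t →
    ∀ p → p ℚ.* p ℚ.≤ seq ‖ (λ i → v m i + - v n i) ‖² t → ℚ.∣ p ∣ ℚ.< ε
  -- Halving ε makes up for the doubling in `≤ᴿ-square⇒<+`.
  difference-small ε 0<ε = let (N , h) = v-cauchy (½ ℚ.* ε) (½-pos 0<ε) in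
    N , λ m n m≥ n≥ → let (T , k) = ≤ᴿ-square⇒<+ (½-pos 0<ε) (h m n m≥ n≥) in
      T , λ t t≥ p p²≤ → subst (ℚ.∣ p ∣ ℚ.<_) (½-split ε) (k t t≥ p p²≤)
  re-cauchy : ∀ i → IsCauchyᴿ (λ n → re (v n i))
  re-cauchy i ε 0<ε = let (N , h) = difference-small ε 0<ε in
    N , λ m n m≥ n≥ → let (T , k) = h m n m≥ n≥ in
      T , λ t t≥ → k t t≥ (seq (re (v m i)) t ℚ.- seq (re (v n i)) t) (re²≤‖‖² (λ j → v m j + - v n j) i t)
  im-cauchy : ∀ i → IsCauchyᴿ (λ n → im (v n i))
  im-cauchy i ε 0<ε = let (N , h) = difference-small ε 0<ε in
    N , λ m n m≥ n≥ → let (T , k) = h m n m≥ n≥ in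
      T , λ t t≥ → k t t≥ (seq (im (v m i)) t ℚ.- seq (im (v n i)) t) (im²≤‖‖² (λ j → v m j + - v n j) i t)
  module Re (i : Fin k) = Limit (λ n → re (v n i)) (re-cauchy i)
  module Im (i : Fin k) = Limit (λ n → im (v n i)) (im-cauchy i)
  l : Vector ℂ k
  l i = Re.limit i +i Im.limit i

-- Conjugation on ℂ and the Hilbert space structure of `ℂ^ k`

ℂ-commutativeSemiring : CommutativeSemiring 0ℓ 0ℓ
ℂ-commutativeSemiring = CommutativeRing.commutativeSemiring ℂ-commutativeRing

private module C = CommutativeSemiring ℂ-commutativeSemiring
open SemiringMorphisms C.rawSemiring C.rawSemiring using (IsSemiringHomomorphism)

conj-cong : ∀ {z w} → z ≈ w → conj z ≈ conj w
conj-cong (p , q) = p , -ᴿ-cong q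

conj-isSemiringHomomorphism : IsSemiringHomomorphism conj
conj-isSemiringHomomorphism = record
  { isNearSemiringHomomorphism = record
    { +-isMonoidHomomorphism = record
      { isMagmaHomomorphism = record
        { isRelHomomorphism = record { cong = conj-cong }
        ; homo = λ z w → pointwise⇒≈ᴿ (λ _ → refl) ,
            pointwise⇒≈ᴿ λ n → ℚ.neg-distrib-+ (seq (im z) n) (seq (im w) n)
        }
      ; ε-homo = pointwise⇒≈ᴿ (λ _ → refl) , pointwise⇒≈ᴿ (λ _ → refl)
      }
    ; *-homo = λ (a +i b) (c +i d) →
        (pointwise⇒≈ᴿ λ n → solve 4 (λ a b c d → a :* c :+ :- (b :* d) := a :* c :+ :- (:- b :* :- d))
          refl (seq a n) (seq b n) (seq c n) (seq d n)) ,
        (pointwise⇒≈ᴿ λ n → solve 4 (λ a b c d → :- (a :* d :+ b :* c) := a :* :- d :+ :- b :* c)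
          refl (seq a n) (seq b n) (seq c n) (seq d n))
    }
  ; 1#-homo = pointwise⇒≈ᴿ (λ _ → refl) , pointwise⇒≈ᴿ (λ _ → refl)
  }
  where open ℚ-Solver using (solve; _:+_; _:*_; _:=_; :-_)

conj-involutive : ∀ z → conj (conj z) ≈ z
conj-involutive (a +i b) = pointwise⇒≈ᴿ (λ _ → refl) ,
  pointwise⇒≈ᴿ λ n → solve 1 (λ b → :- :- b := b) refl (seq b n)
  where open ℚ-Solver using (solve; _:=_; :-_)

open Indicators ℂ-commutativeSemiring using (∑-cong; ∑-distribˡ-*)
open Matrices.Adjoint ℂ-commutativeSemiring conj-isSemiringHomomorphism
  using (⋆-sum; ⋆-+; ⋆-*)

‖v‖²≈0⇒v≈0 : ∀ {k} (v : Vector ℂ k) → ‖ v ‖² ≈ᴿ 0ᴿ → ∀ i → v i ≈ 0ᶜ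
‖v‖²≈0⇒v≈0 v ‖v‖²≈0 i = mk≈ (λ ε 0<ε → let (N , h) = ‖v‖²-small ε 0<ε in
                          N , λ n n≥ → h n n≥ (seq (re (v i)) n) (re²≤‖‖² v i n))
                      , mk≈ (λ ε 0<ε → let (N , h) = ‖v‖²-small ε 0<ε in
                          N , λ n n≥ → h n n≥ (seq (im (v i)) n) (im²≤‖‖² v i n))
  where
  ‖v‖²-small : ∀ ε → 0ℚ ℚ.< ε → ∃[ N ] ∀ n → N ℕ.≤ n → ∀ p → p ℚ.* p ℚ.≤ seq ‖ v ‖² n → ℚ.∣ p ℚ.- 0ℚ ∣ ℚ.< ε
  ‖v‖²-small ε 0<ε = let (N , h) = close ‖v‖²≈0 (ε ℚ.* ε) (*-pos 0<ε 0<ε) in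
    N , λ n n≥ p p²≤ → subst (λ q → ℚ.∣ q ∣ ℚ.< ε) (≡.sym (ℚ.+-identityʳ p))
      (p²<ε²⇒∣p∣<ε p 0<ε (ℚ.≤-<-trans p²≤
        (subst (seq ‖ v ‖² n ℚ.<_) (ℚ.+-identityˡ _) (∣-∣-<⇒< (seq ‖ v ‖² n) 0ℚ (h n n≥)))))

ℂ^-isHilbertSpace : ∀ k → IsHilbertSpace (ℂ^ k) standardInnerProduct
ℂ^-isHilbertSpace k = record
  { isInnerProduct = record
    { ⟨⟩-cong     = λ u≈u′ v≈v′ → ∑-cong k λ i → *-cong (conj-cong (u≈u′ i)) (v≈v′ i)
    ; additiveʳ   = λ u v w → C.trans (∑-cong k λ i → C.distribˡ (conj (u i)) (v i) (w i))
                      (∑-distrib-+ (λ i → conj (u i) * v i) (λ i → conj (u i) * w i))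
    ; homogeneous = λ z u v → C.trans (∑-cong k λ i → x∙yz≈y∙xz (conj (u i)) z (v i))
                      (C.sym (∑-distribˡ-* k z {λ i → conj (u i) * v i}))
    ; hermitian   = λ u v → C.sym (C.trans (⋆-sum (λ i → conj (u i) * v i))
                      (∑-cong k λ i → C.trans (⋆-* (conj (u i)) (v i))
                        (C.trans (*-cong (conj-involutive (u i)) C.refl)
                          (*-comm (u i) (conj (v i))))))
    ; nonNegative = λ v → mk≤ λ ε 0<ε → 0 , λ n _ →
                      ℚ.<-≤-trans 0<ε (subst (ℚ._≤ seq ‖ v ‖² n ℚ.+ ε) (ℚ.+-identityˡ ε)
                        (ℚ.+-monoˡ-≤ ε (‖‖²-nonNeg v n)))
    ; definite    = λ v ⟨v∣v⟩≈0 → ‖v‖²≈0⇒v≈0 v (re≈ ⟨v∣v⟩≈0)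
    }
  ; complete = ℂ^-complete
  }
  where
  open CommutativeSemigroupProperties C.*-commutativeSemigroup using (x∙yz≈y∙xz)
  open Sum C.semiring using (∑-distrib-+)

-- Normalised structure constants

module _ where
  open Mult R.semiring using (×1-homo-*) renaming (_×_ to _⋅_)
  open CommutativeSemigroupProperties R.*-commutativeSemigroup using (interchange; x∙yz≈y∙xz)
  open SetoidReasoning R.setoid

  fromℕ-suc : ∀ m → fromℕ (suc m) ≈ᴿ 1ᴿ +ᴿ fromℕ m
  fromℕ-suc m = pointwise⇒≈ᴿ λ _ → ≡.sym (+/-+ 1 m 1)

  fromℕ≈⋅1 : ∀ m → fromℕ m ≈ᴿ m ⋅ 1ᴿ
  fromℕ≈⋅1 zero    = R.refl
  fromℕ≈⋅1 (suc m) = R.trans (fromℕ-suc m) (R.+-congˡ {1ᴿ} (fromℕ≈⋅1 m))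

  fromℕ-* : ∀ m n → fromℕ (m ℕ.* n) ≈ᴿ fromℕ m *ᴿ fromℕ n
  fromℕ-* m n = begin
    fromℕ (m ℕ.* n)            ≈⟨ fromℕ≈⋅1 (m ℕ.* n) ⟩
    (m ℕ.* n) ⋅ 1ᴿ             ≈⟨ ×1-homo-* m n ⟩
    (m ⋅ 1ᴿ) *ᴿ (n ⋅ 1ᴿ)       ≈⟨ R.*-cong (fromℕ≈⋅1 m) (fromℕ≈⋅1 n) ⟨
    fromℕ m *ᴿ fromℕ n         ∎

  -- The square of `√[ 1 / d ]` serves as the reciprocal of d, by `√-square`.
  fromℕ-cancel : ∀ d .{{_ : NonZero d}} x y → fromℕ d *ᴿ x ≈ᴿ fromℕ d *ᴿ y → x ≈ᴿ y
  fromℕ-cancel d x y dx≈dy = begin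
    x                     ≈⟨ unscale x ⟨
    q *ᴿ (fromℕ d *ᴿ x)   ≈⟨ R.*-congˡ {q} dx≈dy ⟩
    q *ᴿ (fromℕ d *ᴿ y)   ≈⟨ unscale y ⟩
    y                     ∎
    where
    q = √[ 1 / d ] *ᴿ √[ 1 / d ]
    unscale : ∀ z → q *ᴿ (fromℕ d *ᴿ z) ≈ᴿ z
    unscale z = begin
      q *ᴿ (fromℕ d *ᴿ z) ≈⟨ R.*-assoc q (fromℕ d) z ⟨
      (q *ᴿ fromℕ d) *ᴿ z ≈⟨ R.*-congʳ {z} (R.trans (R.*-comm q (fromℕ d)) (√-square 1 d)) ⟩
      1ᴿ *ᴿ z             ≈⟨ R.*-identityˡ z ⟩
      z                   ∎

  -- This turns an identity between roots into one between their squares, so that the integer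
  -- approximations need not be inspected again.
  √-unique : ∀ p d .{{_ : NonZero d}} {y} → NonNegative y → fromℕ d *ᴿ (y *ᴿ y) ≈ᴿ fromℕ p → √[ p / d ] ≈ᴿ y
  √-unique p d {y} 0≤y dy²≈p = square-injective (√-nonNegative p d) 0≤y
    (fromℕ-cancel d _ _ (R.trans (√-square p d) (R.sym dy²≈p)))

  -- By `√-unique` only the square of the right-hand side matters: the factor l √(1/l) squares to l,
  -- while √(1/i) and √(1/j) square to the reciprocals that cancel i j.
  √-split : ∀ l i j .{{_ : NonZero l}} .{{_ : NonZero i}} .{{_ : NonZero j}} .{{_ : NonZero (i ℕ.* j)}} →
    √[ l / i ℕ.* j ] ≈ᴿ (fromℕ l *ᴿ √[ 1 / l ]) *ᴿ (√[ 1 / i ] *ᴿ √[ 1 / j ])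
  √-split l i j = √-unique l (i ℕ.* j)
    (*ᴿ-nonNegative {fromℕ l *ᴿ √[ 1 / l ]} {√[ 1 / i ] *ᴿ √[ 1 / j ]}
      (*ᴿ-nonNegative {fromℕ l} {√[ 1 / l ]} (λ _ → +/-nonNeg l 1) (√-nonNegative 1 l))
      (*ᴿ-nonNegative {√[ 1 / i ]} {√[ 1 / j ]} (√-nonNegative 1 i) (√-nonNegative 1 j)))
    (begin
      fromℕ (i ℕ.* j) *ᴿ ((L *ᴿ (a *ᴿ b)) *ᴿ (L *ᴿ (a *ᴿ b)))
        ≈⟨ R.*-cong (fromℕ-* i j) (R.trans (interchange L (a *ᴿ b) L (a *ᴿ b))
             (R.*-congˡ {L *ᴿ L} (interchange a b a b))) ⟩
      (fromℕ i *ᴿ fromℕ j) *ᴿ ((L *ᴿ L) *ᴿ ((a *ᴿ a) *ᴿ (b *ᴿ b)))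
        ≈⟨ x∙yz≈y∙xz (fromℕ i *ᴿ fromℕ j) (L *ᴿ L) ((a *ᴿ a) *ᴿ (b *ᴿ b)) ⟩
      (L *ᴿ L) *ᴿ ((fromℕ i *ᴿ fromℕ j) *ᴿ ((a *ᴿ a) *ᴿ (b *ᴿ b)))
        ≈⟨ R.*-cong L² (interchange (fromℕ i) (fromℕ j) (a *ᴿ a) (b *ᴿ b)) ⟩
      fromℕ l *ᴿ ((fromℕ i *ᴿ (a *ᴿ a)) *ᴿ (fromℕ j *ᴿ (b *ᴿ b)))
        ≈⟨ R.*-congˡ {fromℕ l} (R.trans (R.*-cong (√-square 1 i) (√-square 1 j)) (R.*-identityˡ 1ᴿ)) ⟩
      fromℕ l *ᴿ 1ᴿ
        ≈⟨ R.*-identityʳ (fromℕ l) ⟩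
      fromℕ l ∎)
    where
    a b c L : ℝ
    a = √[ 1 / i ]
    b = √[ 1 / j ]
    c = √[ 1 / l ]
    L = fromℕ l *ᴿ c
    L² : L *ᴿ L ≈ᴿ fromℕ l
    L² = begin
      (fromℕ l *ᴿ c) *ᴿ (fromℕ l *ᴿ c)
        ≈⟨ R.trans (interchange (fromℕ l) c (fromℕ l) c) (R.*-assoc (fromℕ l) (fromℕ l) (c *ᴿ c)) ⟩
      fromℕ l *ᴿ (fromℕ l *ᴿ (c *ᴿ c)) ≈⟨ R.*-congˡ {fromℕ l} (√-square 1 l) ⟩
      fromℕ l *ᴿ 1ᴿ                    ≈⟨ R.*-identityʳ (fromℕ l) ⟩
      fromℕ l                          ∎

real-cong : ∀ {x y} → x ≈ᴿ y → real x ≈ real y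
real-cong x≈y = x≈y , R.refl

real-+ : ∀ x y → real (x +ᴿ y) ≈ real x + real y
real-+ x y = R.refl , pointwise⇒≈ᴿ λ _ → refl

real-* : ∀ x y → real (x *ᴿ y) ≈ real x * real y
real-* x y =
  (pointwise⇒≈ᴿ λ n → ≡.sym (ℚ.+-identityʳ (seq x n ℚ.* seq y n))) ,
  (pointwise⇒≈ᴿ λ n → ≡.sym (≡.cong₂ ℚ._+_ (ℚ.*-zeroʳ (seq x n)) (ℚ.*-zeroˡ (seq y n))))

conj-real : ∀ x → conj (real x) ≈ real x
conj-real x = R.refl , pointwise⇒≈ᴿ λ _ → refl

module _ where
  open Mult C.semiring using () renaming (_×_ to _⋅_)
  open SetoidReasoning C.setoid

  1/√ : (m : ℕ) .{{_ : NonZero m}} → ℂ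
  1/√ m = real √[ 1 / m ]

  real-fromℕ : ∀ m → real (fromℕ m) ≈ m ⋅ 1ᶜ
  real-fromℕ zero    = C.refl
  real-fromℕ (suc m) = begin
    real (fromℕ (suc m))     ≈⟨ real-cong (fromℕ-suc m) ⟩
    real (1ᴿ +ᴿ fromℕ m)     ≈⟨ real-+ 1ᴿ (fromℕ m) ⟩
    1ᶜ + real (fromℕ m)      ≈⟨ C.+-congˡ {1ᶜ} (real-fromℕ m) ⟩
    1ᶜ + m ⋅ 1ᶜ              ∎

  1/√-inverse : ∀ m .{{_ : NonZero m}} → (m ⋅ 1ᶜ) * (1/√ m * 1/√ m) ≈ 1ᶜ
  1/√-inverse m = begin
    (m ⋅ 1ᶜ) * (1/√ m * 1/√ m)
      ≈⟨ *-cong (real-fromℕ m) (real-* √[ 1 / m ] √[ 1 / m ]) ⟨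
    real (fromℕ m) * real (√[ 1 / m ] *ᴿ √[ 1 / m ])
      ≈⟨ real-* (fromℕ m) (√[ 1 / m ] *ᴿ √[ 1 / m ]) ⟨
    real (fromℕ m *ᴿ (√[ 1 / m ] *ᴿ √[ 1 / m ]))
      ≈⟨ real-cong (√-square 1 m) ⟩
    1ᶜ ∎

  1/√-one : 1/√ 1 ≈ 1ᶜ
  1/√-one = real-cong (√-unique 1 1 {1ᴿ} (λ _ → ℚ.nonNegative⁻¹ 1ℚ) (pointwise⇒≈ᴿ λ _ → refl))

  module _ {n r} (𝒮 : CoherentConfiguration n r) where
    open CoherentConfiguration 𝒮

    τ : Fin r → ℂ
    τ a = 1/√ ∥ a ∥ {{∥∥-nonZero a}}

    ∇•-factor : ∀ i j l → real (∇• i j l) ≈ ((∥ l ∥ ⋅ 1ᶜ) * τ l) * (τ i * τ j) * (∇ i j l ⋅ 1ᶜ)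
    ∇•-factor i j l = begin
      real (√[ ∥ l ∥ / ∥ i ∥ ℕ.* ∥ j ∥ ] *ᴿ fromℕ (∇ i j l))
        ≈⟨ real-* _ _ ⟩
      real √[ ∥ l ∥ / ∥ i ∥ ℕ.* ∥ j ∥ ] * real (fromℕ (∇ i j l))
        ≈⟨ *-cong (real-cong (√-split (∥ l ∥) (∥ i ∥) (∥ j ∥))) (real-fromℕ (∇ i j l)) ⟩
      real ((fromℕ ∥ l ∥ *ᴿ √[ 1 / ∥ l ∥ ]) *ᴿ (√[ 1 / ∥ i ∥ ] *ᴿ √[ 1 / ∥ j ∥ ])) * m
        ≈⟨ C.*-congʳ {m} (real-* (fromℕ ∥ l ∥ *ᴿ √[ 1 / ∥ l ∥ ]) (√[ 1 / ∥ i ∥ ] *ᴿ √[ 1 / ∥ j ∥ ])) ⟩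
      real (fromℕ ∥ l ∥ *ᴿ √[ 1 / ∥ l ∥ ]) * real (√[ 1 / ∥ i ∥ ] *ᴿ √[ 1 / ∥ j ∥ ]) * m
        ≈⟨ C.*-congʳ {m} (*-cong (real-* (fromℕ ∥ l ∥) √[ 1 / ∥ l ∥ ]) (real-* √[ 1 / ∥ i ∥ ] √[ 1 / ∥ j ∥ ])) ⟩
      (real (fromℕ ∥ l ∥) * τ l) * (τ i * τ j) * m
        ≈⟨ C.*-congʳ {m} (C.*-congʳ {τ i * τ j} (C.*-congʳ {τ l} (real-fromℕ ∥ l ∥))) ⟩
      ((∥ l ∥ ⋅ 1ᶜ) * τ l) * (τ i * τ j) * m ∎
      where
      m = ∇ i j l ⋅ 1ᶜ
      instance
        i≢0 = ∥∥-nonZero i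
        j≢0 = ∥∥-nonZero j
        l≢0 = ∥∥-nonZero l
        ij≢0 = ℕ.m*n≢0 (∥ i ∥) (∥ j ∥)

-- Bilinearity of products given by structure constants

module _ {k} (M : Fin k → Fin k → Fin k → ℝ) where
  open Sum C.semiring using (∑-distrib-+)
  open CommutativeSemigroupProperties C.*-commutativeSemigroup using (x∙yz≈y∙xz)
  open SetoidReasoning C.setoid

  private
    term : Vector ℂ k → Vector ℂ k → Fin k → Fin k → Fin k → ℂ
    term u v l i j = u i * v j * real (M i j l)

    ∑∑-cong : {f g : Fin k → Fin k → ℂ} → (∀ i j → f i j ≈ g i j) →
              ∑[ i < k ] ∑[ j < k ] f i j ≈ ∑[ i < k ] ∑[ j < k ] g i j
    ∑∑-cong f≈g = ∑-cong k λ i → ∑-cong k (f≈g i)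

    ∑∑-+ : (f g : Fin k → Fin k → ℂ) →
           ∑[ i < k ] ∑[ j < k ] (f i j + g i j) ≈ ∑[ i < k ] ∑[ j < k ] f i j + ∑[ i < k ] ∑[ j < k ] g i j
    ∑∑-+ f g = C.trans (∑-cong k λ i → ∑-distrib-+ (f i) (g i))
      (∑-distrib-+ (λ i → ∑[ j < k ] f i j) (λ i → ∑[ j < k ] g i j))

    ∑∑-* : ∀ z (f : Fin k → Fin k → ℂ) →
           ∑[ i < k ] ∑[ j < k ] (z * f i j) ≈ z * ∑[ i < k ] ∑[ j < k ] f i j
    ∑∑-* z f = C.sym (C.trans (∑-distribˡ-* k z {λ i → ∑[ j < k ] f i j})
      (∑-cong k λ i → ∑-distribˡ-* k z {f i}))

  bilinear-cong : ∀ {u u′ v v′} → (∀ i → u i ≈ u′ i) → (∀ i → v i ≈ v′ i) →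
                  ∀ l → bilinear M u v l ≈ bilinear M u′ v′ l
  bilinear-cong u≈u′ v≈v′ l = ∑∑-cong λ i j → *-cong (*-cong (u≈u′ i) (v≈v′ j)) C.refl

  -- The marks follow the laws to be supplied: in the additive lemmas ˡ and ʳ give the side of the
  -- factor that is distributed, in the scalar ones the side that is scaled.
  bilinear-+ˡ : ∀ u v w l → bilinear M u (λ i → v i + w i) l ≈ bilinear M u v l + bilinear M u w l
  bilinear-+ˡ u v w l = C.trans
    (∑∑-cong λ i j → C.trans (C.*-congʳ {real (M i j l)} (C.distribˡ (u i) (v j) (w j)))
      (C.distribʳ (real (M i j l)) (u i * v j) (u i * w j)))
    (∑∑-+ (term u v l) (term u w l))

  bilinear-+ʳ : ∀ u v w l → bilinear M (λ i → v i + w i) u l ≈ bilinear M v u l + bilinear M w u l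
  bilinear-+ʳ u v w l = C.trans
    (∑∑-cong λ i j → C.trans (C.*-congʳ {real (M i j l)} (C.distribʳ (u j) (v i) (w i)))
      (C.distribʳ (real (M i j l)) (v i * u j) (w i * u j)))
    (∑∑-+ (term v u l) (term w u l))

  bilinear-*ₗˡ : ∀ z u v l → bilinear M (λ i → z * u i) v l ≈ z * bilinear M u v l
  bilinear-*ₗˡ z u v l = C.trans
    (∑∑-cong λ i j → C.trans (C.*-congʳ {real (M i j l)} (*-assoc z (u i) (v j)))
      (*-assoc z (u i * v j) (real (M i j l))))
    (∑∑-* z (term u v l))

  bilinear-*ₗʳ : ∀ z u v l → bilinear M u (λ i → z * v i) l ≈ z * bilinear M u v l
  bilinear-*ₗʳ z u v l = C.trans
    (∑∑-cong λ i j → C.trans (C.*-congʳ {real (M i j l)} (x∙yz≈y∙xz (u i) z (v j)))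
      (*-assoc z (u i * v j) (real (M i j l))))
    (∑∑-* z (term u v l))

theorem6p6 : ∀ {n r : ℕ} (𝒮 : CoherentConfiguration n r) →
    CoherentConfiguration.IsHalfHomogeneous 𝒮 →
    IsHStarAlgebra (ℂ^ r) standardInnerProduct
    (CoherentConfiguration.L[∇•] 𝒮) (CoherentConfiguration.L[e] 𝒮)
theorem6p6 {n} {r} 𝒮 ½-homogeneous = record
  { isHilbertSpace  = ℂ^-isHilbertSpace r
  ; isUnitalAlgebra = record
    { isMonoid = record
      { isSemigroup = record
        { isMagma = record
          { isEquivalence = LeftModule.≈ᴹ-isEquivalence (ℂ^ r)
          ; ∙-cong        = bilinear-cong ∇•
          }
        ; assoc = ∙-assoc
        }
      ; identity = ∙-identityˡ , ∙-identityʳ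
      }
    ; distrib = bilinear-+ˡ ∇• , bilinear-+ʳ ∇•
    ; *ₗ-·ˡ   = bilinear-*ₗˡ ∇•
    ; *ₗ-·ʳ   = bilinear-*ₗʳ ∇•
    }
  ; _†           = _†
  ; †-antilinear = record
    { f-cong      = λ u≈v i → conj-cong (u≈v (conv i))
    ; additive    = λ u v i → ⋆-+ (u (conv i)) (v (conv i))
    ; conjugating = λ z v i → ⋆-* z (v (conv i))
    }
  ; †-involutive = †-involutive
  ; adjointˡ     = adjointˡ
  ; adjointʳ     = adjointʳ
  }
  where
  open CoherentConfiguration 𝒮
  open Valencies 𝒮 using (conv)
  open Representation ℂ-commutativeSemiring 𝒮
  open Normalised conj-isSemiringHomomorphism conj-involutive 1/√ 1/√-inverse 1/√-one
    (λ m → conj-real √[ 1 / m ]) ½-homogeneous using (_†; †-involutive; module Product)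
  -- For these constants `_∙_`, `e` and the form of `Representation` unfold to `L[∇•]`, `L[e]` and
  -- `standardInnerProduct`, so the laws proved over `K` fill the fields as they stand.
  open Product (λ i j l → real (∇• i j l)) (∇•-factor 𝒮)
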